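{- Let $b_0,b_1,\dots$ and $\lambda_1,\lambda_2,\dots$ be independent indeterminates and work in the field of rational functions in them. For all positive integers $k,m$ and every nonnegative integer $n$, \[ \det\left(\mu^{\le k+m-1}_{n+i+j+2m-2}(\mathbf{b},\boldsymbol{\lambda})\right)_{i,j=0}^{k-1} =\left(\prod_{i=1}^{k+m-1}\lambda_i^{k-i}\right)\left(\det A^{\le k+m-1}(\mathbf{b},\boldsymbol{\lambda})\right)^{n+2m-2} R^{(k+m-1)}\!\left(\det\left(\mu^{\le k+m-1}_{ -n-i-j}(\mathbf{b},\boldsymbol{\lambda})\right)_{i,j=0}^{m-1}\right). \]
   Context: A Motzkin path is a finite sequence of points in $\mathbb{Z}\times\mathbb{Z}_{\ge0}$ whose steps are each $(1,1)$, $(1,0)$ or $(1,-1)$. Its weight is the product of $b_i$ over horizontal steps starting at height $i$ and of $\lambda_i$ over down steps starting at height $i$. $\mu^{\le K}_N(\mathbf{b},\boldsymbol{\lambda})$ ($N\ge0$) is the sum of weights of Motzkin paths from $(0,0)$ to $(N,0)$ staying weakly below $y=K$. Negative indices: if $(f_N)_{N\ge0}$ satisfies $f_N=c_1f_{N-1}+\cdots+c_df_{N-d}$ for all $N\ge d$ with $c_d\ne0$, it is extended uniquely to all $N\in\mathbb{Z}$ so that the recurrence holds for all $N$; $\mu^{\le K}_{ -N}(\mathbf{b},\boldsymbol{\lambda})$ denotes this extension (it exists here). $A^{\le K}(\mathbf{b},\boldsymbol{\lambda})$ is the $(K+1)\times(K+1)$ tridiagonal matrix with rows and columns indexed by $0,\dots,K$,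 diagonal entries $b_0,\dots,b_K$, entries $1$ in positions $(i,i+1)$, and entry $\lambda_i$ in position $(i,i-1)$ for $1\le i\le K$, all other entries $0$. $R^{(N)}$ is the operator on rational functions in $b_0,\dots,b_N,\lambda_1,\dots,\lambda_N$ that replaces each $b_i$ by $b_{N-i}$ and each $\lambda_i$ by $\lambda_{N+1-i}$. -}

module Defs where

open import Level using (Level; _⊔_) renaming (suc to lsuc)
open import Algebra.Bundles using (CommutativeRing)
open import Data.Nat as ℕ using (ℕ; zero; suc; _≤_; _≟_; _≤?_)
open import Data.Integer as ℤ using (ℤ; +_; -[1+_])
open import Data.Fin using (Fin; zero; suc; toℕ; punchIn)
open import Data.List using (List; []; _∷_; map; _++_; foldr)
open import Data.Bool using (if_then_else_)
open import Data.Product using (Σ; _×_)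
open import Relation.Nullary using (¬_; yes; no; does)

record Field (c ℓ : Level) : Set (lsuc (c ⊔ ℓ)) where
  field
    commutativeRing : CommutativeRing c ℓ
  open CommutativeRing commutativeRing public
  field
    inv        : (x : Carrier) → ¬ (x ≈ 0#) → Carrier
    inverse    : ∀ x (p : ¬ (x ≈ 0#)) → x * inv x p ≈ 1#
    nontrivial : ¬ (1# ≈ 0#)

module FieldDefs {c ℓ : Level} (F : Field c ℓ) where
  open Field F public using (Carrier; _≈_; _+_; _*_; -_; 0#; 1#; inv)

  pow : Carrier → ℕ → Carrier
  pow x zero    = 1#
  pow x (suc n) = x * pow x n

  ipow : (x : Carrier) → ¬ (x ≈ 0#) → ℤ → Carrier
  ipow x nz (+ n)    = pow x n
  ipow x nz -[1+ n ] = pow (inv x nz) (suc n)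

  sumRange : ℕ → (ℕ → Carrier) → Carrier
  sumRange zero    f = 0#
  sumRange (suc n) f = sumRange n f + f n

  prodRange : ℕ → (ℕ → Carrier) → Carrier
  prodRange zero    f = 1#
  prodRange (suc n) f = prodRange n f * f n

  sumFin : ∀ n → (Fin n → Carrier) → Carrier
  sumFin zero    f = 0#
  sumFin (suc n) f = f zero + sumFin n (λ i → f (suc i))

  sumList : List Carrier → Carrier
  sumList = foldr _+_ 0#

  sign : ℕ → Carrier
  sign zero    = 1#
  sign (suc j) = - sign j

  det : ∀ n → (Fin n → Fin n → Carrier) → Carrier
  det zero    M = 1#
  det (suc n) M =
    sumFin (suc n) (λ j → sign (toℕ j) * (M zero j * det n (λ r s → M (suc r) (punchIn j s))))

  -- Motzkin paths.  b i = b_i, lam i = λ_i (lam 0 is never used).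
  -- Path K h N : Motzkin paths of N steps starting at height h and ending
  -- at height 0, never going above height K (paths considered start at
  -- height 0, so every visited height lies in [0,K]).
  data Path (K : ℕ) : ℕ → ℕ → Set where
    done : Path K 0 0
    flat : ∀ {h N} → Path K h N → Path K h (suc N)
    up   : ∀ {h N} → suc h ≤ K → Path K (suc h) N → Path K h (suc N)
    down : ∀ {h N} → Path K h N → Path K (suc h) (suc N)

  weight : ∀ {K h N} → (ℕ → Carrier) → (ℕ → Carrier) → Path K h N → Carrier
  weight b lam done             = 1#
  weight b lam (flat {h} p)     = b h * weight b lam p
  weight b lam (up _ p)         = weight b lam p
  weight b lam (down {h} p)     = lam (suc h) * weight b lam p

  allPaths : ∀ K h N → List (Path K h N)
  allPaths K zero    zero    = done ∷ []
  allPaths K (suc h) zero    = []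
  allPaths K h       (suc N) = map flat (allPaths K h N) ++ (upPart h ++ downPart h)
    where
    upPart : ∀ h → List (Path K h (suc N))
    upPart h with suc h ≤? K
    ... | yes p = map (up p) (allPaths K (suc h) N)
    ... | no  _ = []
    downPart : ∀ h → List (Path K h (suc N))
    downPart zero    = []
    downPart (suc h) = map down (allPaths K h N)

  μ : ℕ → (ℕ → Carrier) → (ℕ → Carrier) → ℕ → Carrier
  μ K b lam N = sumList (map (weight b lam) (allPaths K 0 N))

  triEntry : (ℕ → Carrier) → (ℕ → Carrier) → ℕ → ℕ → Carrier
  triEntry b lam i j =
    if does (i ≟ j) then b i
    else if does (suc i ≟ j) then 1#
    else if does (i ≟ suc j) then lam i
    else 0#

  A : (K : ℕ) → (ℕ → Carrier) → (ℕ → Carrier) → Fin (suc K) → Fin (suc K) → Carrier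
  A K b lam i j = triEntry b lam (toℕ i) (toℕ j)

  -- g : ℤ → F is the extension to all of ℤ of (μ^{≤K}_N)_{N≥0}:
  -- it agrees with μ^{≤K}_N for N ≥ 0 and satisfies, for all N ∈ ℤ,
  -- a linear recurrence g N = c_1 g(N-1) + ... + c_d g(N-d), d ≥ 1, c_d ≠ 0.
  -- (Such an extension is unique; μ^{≤K}_{-N} = g (-N).)
  IsMuExtension : ℕ → (ℕ → Carrier) → (ℕ → Carrier) → (ℤ → Carrier) → Set (c ⊔ ℓ)
  IsMuExtension K b lam g =
    (∀ N → g (+ N) ≈ μ K b lam N) ×
    Σ ℕ (λ d → Σ (ℕ → Carrier) (λ cs →
      ¬ (cs (suc d) ≈ 0#) ×
      (∀ (N : ℤ) → g N ≈ sumRange (suc d) (λ i → cs (suc i) * g (N ℤ.- + suc i)))))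

  -- R^{(K)} on the parameters: b_i ↦ b_{K-i}, λ_i ↦ λ_{K+1-i}
  revB : ℕ → (ℕ → Carrier) → (ℕ → Carrier)
  revB K b i = b (K ℕ.∸ i)

  revLam : ℕ → (ℕ → Carrier) → (ℕ → Carrier)
  revLam K lam i = lam (suc K ℕ.∸ i)

  lamProd : (lam : ℕ → Carrier) → (∀ i → ¬ (lam (suc i) ≈ 0#)) → ℕ → ℕ → Carrier
  lamProd lam nz K k = prodRange K (λ i → ipow (lam (suc i)) (nz i) (+ k ℤ.- + suc i))

{-# OPTIONS --safe #-}
-- Let K = k+m-1 and let A be the tridiagonal matrix, so that μ_N = e₀ᵀ A^N e₀.  Reversing the basis
-- transposes the matrix of the reversed parameters into A, so R(μ_{-N}) = e_Kᵀ A^{-N} e_K.  The rows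
-- e₀ᵀ A^i (i < k) and e_Kᵀ A^{-(n+2m-2)+m-1-j} (j < m) form a square matrix X.  Multiplying X by the
-- columns A^{K-l} e_K (a unitriangular matrix) gives a block triangular matrix with determinant the
-- Hankel determinant on the right; multiplying X A^{n+2m-2} by the columns A^l e₀ (triangular with
-- diagonal λ₁⋯λ_l) gives one whose determinant is the Hankel determinant on the left times
-- (λ₁⋯λ_K)^m.  Comparing the two yields the identity; no inverse of A is needed, because the row
-- vectors with negative exponents are read off directly from the given extension of μ.
module Submission where

open import Defs
open import Data.Nat as ℕ using (ℕ; zero; suc; _≤_; _<_; _∸_; z≤n; s≤s)
import Data.Nat.Properties as ℕ
import Data.Nat.Tactic.RingSolver as ℕ-Solver
open import Data.Integer as ℤ using (ℤ; +_)
import Data.Integer.Properties as ℤ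
open import Data.Integer.Tactic.RingSolver using (solve-∀)
open import Data.Fin as Fin using (Fin; zero; suc; toℕ; punchIn; opposite; _↑ˡ_; _↑ʳ_)
open import Data.Fin.Properties using (toℕ<n; toℕ-↑ˡ; toℕ-↑ʳ; opposite-prop; opposite-involutive)
open import Data.Product using (_×_; _,_; proj₁; proj₂)
open import Data.Unit.Polymorphic using (⊤; tt)
open import Function using (_∘_)
open import Level using (Level; _⊔_)
open import Relation.Binary.PropositionalEquality as ≡ using (_≡_)
open import Relation.Nullary using (¬_; yes; no; contradiction)
open import Relation.Nullary.Decidable using (dec-true; dec-false)

-- Since `det` is given only as an expansion along the first row, its multiplicativity is derived
-- from the uniqueness of alternating functionals of the rows. A transpose is avoided throughout:
-- reversing both index orders turns statements about upper triangular matrices into statements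
-- about lower triangular ones. The second obstacle is that the extension of `μ` comes with a
-- recurrence of unknown order and coefficients. What it yields is that a sequence obeying the same
-- recurrence and vanishing for N ≥ 0 vanishes everywhere. Applied to the coordinate just above
-- height K, this closes the last row of the matrix relation at negative times. The exponents k-i
-- arise as follows: the columns A^l e₀ have determinant ∏_l λ₁⋯λ_l, in which λ_i occurs K+1-i
-- times, and cancelling (λ₁⋯λ_K)^m leaves K+1-m-i = k-i.

module Determinants {c ℓ : Level} (F : Field c ℓ) where
  open import Data.Vec.Functional using (Vector; _∷_; head; tail; insertAt)
  open Field F public using
    ( Carrier; _≈_; _+_; _*_; -_; 0#; 1#; refl; sym; trans; reflexive; setoid
    ; +-cong; +-congˡ; +-congʳ; *-cong; *-congˡ; *-congʳ; -‿cong
    ; +-identityˡ; +-identityʳ; *-identityˡ; *-identityʳ; +-assoc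
    ; *-comm; *-assoc; distribˡ; distribʳ; zeroˡ; zeroʳ; -‿inverseʳ
    ; commutativeSemiring; ring )
  open FieldDefs F public using (pow; sumFin; sumRange; prodRange; det; sign)
  open import Algebra.Properties.Ring ring public
    using (+-cancelˡ; -‿distribˡ-*; -‿distribʳ-*; -0#≈0#; -‿involutive; +-inverseˡ-unique)
  open import Algebra.Solver.Ring.NaturalCoefficients.Default commutativeSemiring public
    using (solve; _:=_; _:+_; _:*_)
  open import Relation.Binary.Reasoning.Setoid setoid public

  -- Finite sums.

  0+0≈0 : ∀ {x y} → x ≈ 0# → y ≈ 0# → x + y ≈ 0#
  0+0≈0 p q = trans (+-cong p q) (+-identityˡ 0#)

  *-zero : ∀ {x y} → y ≈ 0# → x * y ≈ 0#
  *-zero p = trans (*-congˡ p) (zeroʳ _)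

  zero-* : ∀ {x y} → x ≈ 0# → x * y ≈ 0#
  zero-* p = trans (*-congʳ p) (zeroˡ _)

  sumFin-cong : ∀ n {f g : Vector Carrier n} → (∀ i → f i ≈ g i) → sumFin n f ≈ sumFin n g
  sumFin-cong zero    p = refl
  sumFin-cong (suc n) p = +-cong (p zero) (sumFin-cong n (p ∘ suc))

  sumFin-zero : ∀ n {f : Vector Carrier n} → (∀ i → f i ≈ 0#) → sumFin n f ≈ 0#
  sumFin-zero zero    p = refl
  sumFin-zero (suc n) p = 0+0≈0 (p zero) (sumFin-zero n (p ∘ suc))

  sumFin-+ : ∀ n (f g : Vector Carrier n) →
             sumFin n (λ i → f i + g i) ≈ sumFin n f + sumFin n g
  sumFin-+ zero    f g = sym (+-identityˡ 0#)
  sumFin-+ (suc n) f g = trans (+-congˡ (sumFin-+ n (tail f) (tail g)))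
    (solve 4 (λ a b x y → (a :+ b) :+ (x :+ y) := (a :+ x) :+ (b :+ y)) refl _ _ _ _)

  sumFin-*ˡ : ∀ n a (f : Vector Carrier n) → sumFin n (λ i → a * f i) ≈ a * sumFin n f
  sumFin-*ˡ zero    a f = sym (zeroʳ a)
  sumFin-*ˡ (suc n) a f = trans (+-congˡ (sumFin-*ˡ n a (tail f))) (sym (distribˡ a _ _))

  sumFin-*ʳ : ∀ n a (f : Vector Carrier n) → sumFin n (λ i → f i * a) ≈ sumFin n f * a
  sumFin-*ʳ n a f = trans (sumFin-cong n (λ i → *-comm (f i) a))
                          (trans (sumFin-*ˡ n a f) (*-comm a _))

  sumFin-swap : ∀ m n (f : Fin m → Fin n → Carrier) →
    sumFin m (λ i → sumFin n (f i)) ≈ sumFin n (λ j → sumFin m (λ i → f i j))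
  sumFin-swap zero    n f = sym (sumFin-zero n (λ _ → refl))
  sumFin-swap (suc m) n f =
    trans (+-congˡ (sumFin-swap m n (f ∘ suc))) (sym (sumFin-+ n _ _))

  sumFin-↑ : ∀ k m (f : Vector Carrier (k ℕ.+ m)) →
    sumFin (k ℕ.+ m) f ≈ sumFin k (λ i → f (i ↑ˡ m)) + sumFin m (λ i → f (k ↑ʳ i))
  sumFin-↑ zero    m f = sym (+-identityˡ _)
  sumFin-↑ (suc k) m f = trans (+-congˡ (sumFin-↑ k m (f ∘ suc))) (sym (+-assoc _ _ _))

  -- Row vectors, linear functionals and linear maps.

  Row : ℕ → Set c
  Row = Vector Carrier

  infix 4 _≋_
  _≋_ : ∀ {q} → Row q → Row q → Set ℓ
  x ≋ y = ∀ i → x i ≈ y i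

  _⊕_ : ∀ {q} → Row q → Row q → Row q
  (x ⊕ y) i = x i + y i

  _⊛_ : ∀ {q} → Carrier → Row q → Row q
  (a ⊛ x) i = a * x i

  0ᵣ : ∀ {q} → Row q
  0ᵣ _ = 0#

  -- Rows are functions compared pointwise by `_≋_`, so compatibility with that equality has to be
  -- an axiom.
  record Linear {q} (f : Row q → Carrier) : Set (c ⊔ ℓ) where
    field
      cong  : ∀ {x y} → x ≋ y → f x ≈ f y
      add   : ∀ x y → f (x ⊕ y) ≈ f x + f y
      scale : ∀ a x → f (a ⊛ x) ≈ a * f x

    null : f 0ᵣ ≈ 0#
    null = begin
      f 0ᵣ        ≈⟨ cong (λ i → sym (zeroˡ 0#)) ⟩
      f (0# ⊛ 0ᵣ) ≈⟨ scale 0# 0ᵣ ⟩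
      0# * f 0ᵣ   ≈⟨ zeroˡ _ ⟩
      0#          ∎

    sum : ∀ n (a : Vector Carrier n) (v : Fin n → Row q) →
          f (λ s → sumFin n (λ j → a j * v j s)) ≈ sumFin n (λ j → a j * f (v j))
    sum zero    a v = null
    sum (suc n) a v = trans (add _ _) (+-cong (scale _ _) (sum n (tail a) (tail v)))

  record LinearMap {p q} (L : Row p → Row q) : Set (c ⊔ ℓ) where
    field
      cong  : ∀ {x y} → x ≋ y → L x ≋ L y
      add   : ∀ x y → L (x ⊕ y) ≋ L x ⊕ L y
      scale : ∀ a x → L (a ⊛ x) ≋ a ⊛ L x

  -- Alternating multilinear functionals of the rows.

  Rows : ℕ → ℕ → Set c
  Rows n q = Vector (Row q) n

  ∷-≋ : ∀ {n q} {x y : Row q} {r s : Rows n q} →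
        x ≋ y → (∀ i → r i ≋ s i) → ∀ i → (x ∷ r) i ≋ (y ∷ s) i
  ∷-≋ p q zero    = p
  ∷-≋ p q (suc i) = q i

  ∷-η : ∀ {n q} (r : Rows (suc n) q) → ∀ i → r i ≋ (head r ∷ tail r) i
  ∷-η r zero    j = refl
  ∷-η r (suc i) j = refl

  Congruent : ∀ {n q} → (Rows n q → Carrier) → Set (c ⊔ ℓ)
  Congruent F = ∀ {r s} → (∀ i → r i ≋ s i) → F r ≈ F s

  VanishesOnRepeat : ∀ n {q} → (Rows (suc n) q → Carrier) → Set (c ⊔ ℓ)
  VanishesOnRepeat zero    F = ⊤
  VanishesOnRepeat (suc n) F = ∀ x r → F (x ∷ x ∷ r) ≈ 0#

  -- Only adjacent repeated rows are required to kill F; vanish extends this to all pairs.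
  Alternating : ∀ n {q} → (Rows n q → Carrier) → Set (c ⊔ ℓ)
  Alternating zero    F = Congruent F
  Alternating (suc n) F =
    Congruent F × (∀ r → Linear (λ x → F (x ∷ r))) ×
    (∀ x → Alternating n (λ r → F (x ∷ r))) × VanishesOnRepeat n F

  congruent : ∀ n {q} {F : Rows n q → Carrier} → Alternating n F → Congruent F
  congruent zero    alt = alt
  congruent (suc n) alt = proj₁ alt

  Alternating-resp : ∀ n {q} {F G : Rows n q → Carrier} →
                     (∀ r → G r ≈ F r) → Alternating n F → Alternating n G
  Alternating-resp zero    e alt p = trans (e _) (trans (alt p) (sym (e _)))
  Alternating-resp (suc n) e (cg , lin , alt , van) =
    (λ p → trans (e _) (trans (cg p) (sym (e _)))) ,
    (λ r → record
      { cong  = λ p → trans (e _) (trans (Linear.cong (lin r) p) (sym (e _)))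
      ; add   = λ x y → trans (e _) (trans (Linear.add (lin r) x y) (sym (+-cong (e _) (e _))))
      ; scale = λ a x → trans (e _) (trans (Linear.scale (lin r) a x) (sym (*-congˡ (e _)))) }) ,
    (λ x → Alternating-resp n (λ r → e (x ∷ r)) (alt x)) ,
    van-resp n e van
    where
    van-resp : ∀ n {q} {F G : Rows (suc n) q → Carrier} → (∀ r → G r ≈ F r) →
               VanishesOnRepeat n F → VanishesOnRepeat n G
    van-resp zero    e van     = tt
    van-resp (suc n) e van x r = trans (e _) (van x r)

  Alternating-scale : ∀ n {q} {F : Rows n q → Carrier} a →
                      Alternating n F → Alternating n (λ r → a * F r)
  Alternating-scale zero    a alt p = *-congˡ (alt p)
  Alternating-scale (suc n) a (cg , lin , alt , van) =
    (λ p → *-congˡ (cg p)) ,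
    (λ r → record
      { cong  = λ p → *-congˡ (Linear.cong (lin r) p)
      ; add   = λ x y → trans (*-congˡ (Linear.add (lin r) x y)) (distribˡ a _ _)
      ; scale = λ b x → trans (*-congˡ (Linear.scale (lin r) b x))
                  (solve 3 (λ a b y → a :* (b :* y) := b :* (a :* y)) refl a b _) }) ,
    (λ x → Alternating-scale n a (alt x)) ,
    van-scale n van
    where
    van-scale : ∀ n {q} {F : Rows (suc n) q → Carrier} →
                VanishesOnRepeat n F → VanishesOnRepeat n (λ r → a * F r)
    van-scale zero    van     = tt
    van-scale (suc n) van x r = *-zero (van x r)

  -- Applied with `L` deleting a column, inserting a zero column, and multiplying by a matrix from
  -- the right.
  Alternating-map : ∀ n {p q} {F : Rows n q → Carrier} {L : Row p → Row q} →
                    LinearMap L → Alternating n F → Alternating n (λ r → F (L ∘ r))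
  Alternating-map zero    map alt p = alt (λ i → LinearMap.cong map (p i))
  Alternating-map (suc n) {F = F} {L} map (cg , lin , alt , van) =
    (λ p → cg (λ i → L.cong (p i))) ,
    (λ r → record
      { cong  = λ p → cg (λ { zero → L.cong p ; (suc i) _ → refl })
      ; add   = λ x y → trans (split _ r) (trans (Linear.cong (lin _) (L.add x y))
                  (trans (Linear.add (lin _) _ _) (sym (+-cong (split x r) (split y r)))))
      ; scale = λ a x → trans (split _ r) (trans (Linear.cong (lin _) (L.scale a x))
                  (trans (Linear.scale (lin _) _ _) (sym (*-congˡ (split x r))))) }) ,
    (λ x → Alternating-resp n (split x) (Alternating-map n map (alt (L x)))) ,
    van-map n van cg
    where
    module L = LinearMap map
    split : ∀ x r → F (L ∘ (x ∷ r)) ≈ F (L x ∷ L ∘ r)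
    split x r = cg (λ { zero _ → refl ; (suc i) _ → refl })
    van-map : ∀ n {F} → VanishesOnRepeat n F → Congruent F →
              VanishesOnRepeat n (λ r → F (L ∘ r))
    van-map zero    van cg     = tt
    van-map (suc n) van cg x r =
      trans (cg (λ { zero _ → refl ; (suc zero) _ → refl ; (suc (suc i)) _ → refl }))
            (van (L x) (L ∘ r))

  Alternating-sum : ∀ n {q} m {G : Fin m → Rows n q → Carrier} →
                    (∀ j → Alternating n (G j)) → Alternating n (λ r → sumFin m (λ j → G j r))
  Alternating-sum zero    m alt p = sumFin-cong m (λ j → alt j p)
  Alternating-sum (suc n) m alt =
    (λ p → sumFin-cong m (λ j → proj₁ (alt j) p)) ,
    (λ r → record
      { cong  = λ p → sumFin-cong m (λ j → Linear.cong (lin j r) p)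
      ; add   = λ x y → trans (sumFin-cong m (λ j → Linear.add (lin j r) x y)) (sumFin-+ m _ _)
      ; scale = λ a x → trans (sumFin-cong m (λ j → Linear.scale (lin j r) a x)) (sumFin-*ˡ m a _) }) ,
    (λ x → Alternating-sum n m (λ j → proj₁ (proj₂ (proj₂ (alt j))) x)) ,
    van-sum n (λ j → proj₂ (proj₂ (proj₂ (alt j))))
    where
    lin : ∀ j r → Linear _
    lin j = proj₁ (proj₂ (alt j))
    van-sum : ∀ n {q} {G : Fin m → Rows (suc n) q → Carrier} →
              (∀ j → VanishesOnRepeat n (G j)) → VanishesOnRepeat n (λ r → sumFin m (λ j → G j r))
    van-sum zero    van     = tt
    van-sum (suc n) van x r = sumFin-zero m (λ j → van j x r)

  -- Polarisation: expand the value 0 at the repeated row `x ⊕ y`.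
  swap : ∀ n {q} {F : Rows (suc (suc n)) q → Carrier} → Alternating (suc (suc n)) F →
         ∀ x y r → F (x ∷ y ∷ r) ≈ - F (y ∷ x ∷ r)
  swap n {F = F} (cg , lin , alt , van) x y r = +-inverseˡ-unique _ _ (sym (begin
    0#                                          ≈⟨ van (x ⊕ y) r ⟨
    F ((x ⊕ y) ∷ (x ⊕ y) ∷ r)                   ≈⟨ Linear.add (lin _) x y ⟩
    F (x ∷ (x ⊕ y) ∷ r) + F (y ∷ (x ⊕ y) ∷ r)   ≈⟨ +-cong (Linear.add (lin₂ x) x y)
                                                          (Linear.add (lin₂ y) x y) ⟩
    (F (x ∷ x ∷ r) + F (x ∷ y ∷ r)) + (F (y ∷ x ∷ r) + F (y ∷ y ∷ r))
      ≈⟨ +-cong (trans (+-congʳ (van x r)) (+-identityˡ _))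
                (trans (+-congˡ (van y r)) (+-identityʳ _)) ⟩
    F (x ∷ y ∷ r) + F (y ∷ x ∷ r)               ∎))
    where
    lin₂ : ∀ z → Linear (λ x → F (z ∷ x ∷ r))
    lin₂ z = proj₁ (proj₂ (alt z)) r

  vanish : ∀ n {q} {F : Rows (suc n) q → Carrier} → Alternating (suc n) F →
           ∀ x r i → r i ≋ x → F (x ∷ r) ≈ 0#
  vanish (suc n) (cg , lin , alt , van) x r zero    p =
    trans (cg (∷-≋ (λ _ → refl) (λ { zero → p ; (suc i) _ → refl }))) (van x (tail r))
  vanish (suc n) {F = F} A@(cg , lin , alt , van) x r (suc i) p = begin
    F (x ∷ r)                 ≈⟨ cg (∷-≋ (λ _ → refl) (∷-η r)) ⟩
    F (x ∷ head r ∷ tail r)   ≈⟨ swap n A x (head r) (tail r) ⟩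
    - F (head r ∷ x ∷ tail r) ≈⟨ -‿cong (vanish n (alt (head r)) x (tail r) i p) ⟩
    - 0#                      ≈⟨ -0#≈0# ⟩
    0#                        ∎

  -- Row `j` passes over `j` rows by adjacent swaps, which produces the sign that the Laplace
  -- expansion attaches to column `j`.
  move-to-front : ∀ n {q} {F : Rows (suc n) q → Carrier} → Alternating (suc n) F →
                  ∀ j r → F (r j ∷ r ∘ punchIn j) ≈ sign (toℕ j) * F r
  move-to-front n       (cg , _) zero    r =
    trans (cg (λ { zero _ → refl ; (suc i) _ → refl })) (sym (*-identityˡ _))
  move-to-front (suc n) {F = F} A@(cg , lin , alt , van) (suc j) r = begin
    F (r (suc j) ∷ r ∘ punchIn (suc j))
      ≈⟨ cg (∷-≋ (λ _ → refl) (λ { zero _ → refl ; (suc i) _ → refl })) ⟩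
    F (r (suc j) ∷ head r ∷ tail r ∘ punchIn j)
      ≈⟨ swap n A (r (suc j)) (head r) _ ⟩
    - F (head r ∷ r (suc j) ∷ tail r ∘ punchIn j)
      ≈⟨ -‿cong (move-to-front n (alt (head r)) j (tail r)) ⟩
    - (sign (toℕ j) * F (head r ∷ tail r))
      ≈⟨ -‿cong (*-congˡ (cg (∷-η r))) ⟨
    - (sign (toℕ j) * F r)
      ≈⟨ -‿distribˡ-* _ _ ⟩
    - sign (toℕ j) * F r ∎

  -- The row `x` is not among the arguments of `F`: in the application it has been fixed in front of
  -- them. `van` expresses that repetition with the fixed row kills `F`, and it passes to the
  -- functional with one more row fixed.
  clear-rows : ∀ n {q} {F : Rows n q → Carrier} → Alternating n F →
               ∀ x → (∀ r i → r i ≋ x → F r ≈ 0#) →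
               ∀ r (a : Vector Carrier n) → F (λ i → r i ⊕ (a i ⊛ x)) ≈ F r
  clear-rows zero    alt x van r a = alt (λ ())
  clear-rows (suc n) {F = F} (cg , lin , alt , _) x van r a = begin
    F r′                                       ≈⟨ cg (∷-η r′) ⟩
    F ((head r ⊕ (head a ⊛ x)) ∷ tail r′)      ≈⟨ Linear.add (lin _) _ _ ⟩
    F (head r ∷ tail r′) + F ((head a ⊛ x) ∷ tail r′)
      ≈⟨ +-congˡ (trans (Linear.scale (lin _) _ _) (*-zero (van _ zero (λ _ → refl)))) ⟩
    F (head r ∷ tail r′) + 0#                  ≈⟨ +-identityʳ _ ⟩
    F (head r ∷ tail r′)
      ≈⟨ clear-rows n (alt (head r)) x (λ s i p → van (head r ∷ s) (suc i) p) (tail r) (tail a) ⟩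
    F (head r ∷ tail r)                        ≈⟨ cg (∷-η r) ⟨
    F r                                        ∎
    where
    r′ : Rows (suc n) _
    r′ i = r i ⊕ (a i ⊛ x)

  -- Unit vectors and the uniqueness of alternating functionals.

  unit : ∀ {n} → Fin n → Fin n → Carrier
  unit zero    zero    = 1#
  unit zero    (suc j) = 0#
  unit (suc i) zero    = 0#
  unit (suc i) (suc j) = unit i j

  sum-unit : ∀ n (x : Row n) s → sumFin n (λ j → x j * unit j s) ≈ x s
  sum-unit (suc n) x zero    =
    trans (+-cong (*-identityʳ _) (sumFin-zero n (λ j → zeroʳ _))) (+-identityʳ _)
  sum-unit (suc n) x (suc s) =
    trans (+-cong (zeroʳ _) (sum-unit n (tail x) s)) (+-identityˡ _)

  unit-sum : ∀ n (x : Row n) s → sumFin n (λ j → unit s j * x j) ≈ x s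
  unit-sum (suc n) x zero    =
    trans (+-cong (*-identityˡ _) (sumFin-zero n (λ j → zeroˡ _))) (+-identityʳ _)
  unit-sum (suc n) x (suc s) =
    trans (+-cong (zeroˡ _) (unit-sum n (tail x) s)) (+-identityˡ _)

  -- A right inverse of deleting column `j`. Composing with it turns a functional on rows of length
  -- n+1 into one on rows of length n, to which the induction in `alternating-det` applies.
  insert₀ : ∀ {n} → Fin (suc n) → Row n → Row (suc n)
  insert₀ j x = insertAt x j 0#

  insert₀-linear : ∀ {n} j → LinearMap (insert₀ {n} j)
  insert₀-linear zero = record
    { cong  = λ { p zero → refl ; p (suc i) → p i }
    ; add   = λ { x y zero → sym (+-identityˡ 0#) ; x y (suc i) → refl }
    ; scale = λ { a x zero → sym (zeroʳ a) ; a x (suc i) → refl } }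
  insert₀-linear {suc n} (suc j) = record
    { cong  = λ { p zero → p zero ; p (suc i) → I.cong (p ∘ suc) i }
    ; add   = λ { x y zero → refl ; x y (suc i) → I.add (tail x) (tail y) i }
    ; scale = λ { a x zero → refl ; a x (suc i) → I.scale a (tail x) i } }
    where module I = LinearMap (insert₀-linear j)

  insert₀-0ᵣ : ∀ {n} j → insert₀ {n} j 0ᵣ ≋ 0ᵣ
  insert₀-0ᵣ zero    zero    = refl
  insert₀-0ᵣ zero    (suc s) = refl
  insert₀-0ᵣ {suc n} (suc j) zero    = refl
  insert₀-0ᵣ {suc n} (suc j) (suc s) = insert₀-0ᵣ j s

  insert₀-unit : ∀ {n} j (i : Fin n) → insert₀ j (unit i) ≋ unit (punchIn j i)
  insert₀-unit zero    i       zero    = refl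
  insert₀-unit zero    i       (suc s) = refl
  insert₀-unit (suc j) zero    zero    = refl
  insert₀-unit {suc n} (suc j) zero (suc s) = insert₀-0ᵣ j s
  insert₀-unit (suc j) (suc i) zero    = refl
  insert₀-unit (suc j) (suc i) (suc s) = insert₀-unit j i s

  insert₀-decompose : ∀ {n} (x : Row (suc n)) j →
                      x ≋ (insert₀ j (x ∘ punchIn j) ⊕ (x j ⊛ unit j))
  insert₀-decompose x zero zero    = sym (trans (+-identityˡ _) (*-identityʳ _))
  insert₀-decompose x zero (suc s) = sym (trans (+-congˡ (zeroʳ _)) (+-identityʳ _))
  insert₀-decompose {suc n} x (suc j) zero    = sym (trans (+-congˡ (zeroʳ _)) (+-identityʳ _))
  insert₀-decompose {suc n} x (suc j) (suc s) = insert₀-decompose (tail x) j s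

  -- Every alternating functional is a multiple of det: expand the first row in unit vectors,
  -- clear column j below the unit vector e_j, and recurse on the remaining minor.
  alternating-det : ∀ n {F : Rows n n → Carrier} → Alternating n F →
                    ∀ M → F M ≈ det n M * F unit
  alternating-det zero    alt M = trans (alt (λ ())) (sym (*-identityˡ _))
  alternating-det (suc n) {F} A@(cg , lin , alt , van) M = begin
    F M                                               ≈⟨ cg (∷-η M) ⟩
    F (head M ∷ tail M)
      ≈⟨ Linear.cong (lin _) (λ s → sym (sum-unit (suc n) (head M) s)) ⟩
    F ((λ s → sumFin (suc n) (λ j → head M j * unit j s)) ∷ tail M)
      ≈⟨ Linear.sum (lin (tail M)) (suc n) (head M) unit ⟩
    sumFin (suc n) (λ j → head M j * F (unit j ∷ tail M))
      ≈⟨ sumFin-cong (suc n) (λ j → trans (*-congˡ (expand j))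
           (solve 4 (λ a b d f → a :* (d :* (b :* f)) := (b :* (a :* d)) :* f) refl
              (head M j) (sign (toℕ j)) (det n (minor j)) (F unit))) ⟩
    sumFin (suc n) (λ j → (sign (toℕ j) * (head M j * det n (minor j))) * F unit)
      ≈⟨ sumFin-*ʳ (suc n) (F unit) (λ j → sign (toℕ j) * (head M j * det n (minor j))) ⟩
    det (suc n) M * F unit                            ∎
    where
    minor : Fin (suc n) → Fin n → Fin n → Carrier
    minor j r s = M (suc r) (punchIn j s)
    expand : ∀ j → F (unit j ∷ tail M) ≈ det n (minor j) * (sign (toℕ j) * F unit)
    expand j = begin
      F (unit j ∷ tail M)
        ≈⟨ congruent n (alt (unit j)) (λ i → insert₀-decompose (tail M i) j) ⟩
      F (unit j ∷ (λ i → insert₀ j (minor j i) ⊕ (tail M i j ⊛ unit j)))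
        ≈⟨ clear-rows n (alt (unit j)) (unit j) (vanish n A (unit j)) _ _ ⟩
      F (unit j ∷ insert₀ j ∘ minor j)
        ≈⟨ alternating-det n (Alternating-map n (insert₀-linear j) (alt (unit j))) (minor j) ⟩
      det n (minor j) * F (unit j ∷ insert₀ j ∘ unit)
        ≈⟨ *-congˡ (congruent n (alt (unit j)) (insert₀-unit j)) ⟩
      det n (minor j) * F (unit j ∷ unit ∘ punchIn j)
        ≈⟨ *-congˡ (move-to-front n A j unit) ⟩
      det n (minor j) * (sign (toℕ j) * F unit) ∎

  -- The Laplace expansion is alternating.

  laplace : ∀ n → Rows (suc n) (suc n) → Fin (suc n) → Carrier
  laplace n M j = sign (toℕ j) * (M zero j * det n (λ r s → M (suc r) (punchIn j s)))

  det-cong : ∀ n {M N : Rows n n} → (∀ i → M i ≋ N i) → det n M ≈ det n N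
  det-cong zero            p = refl
  det-cong (suc n) {M} {N} p = sumFin-cong (suc n) {laplace n M} {laplace n N} (λ j →
    *-congˡ {sign (toℕ j)} (*-cong (p zero j) (det-cong n (λ r s → p (suc r) (punchIn j s)))))

  signs-cancel : ∀ x y → - x * - y ≈ x * y
  signs-cancel x y = begin
    - x * - y     ≈⟨ -‿distribˡ-* x (- y) ⟨
    - (x * - y)   ≈⟨ -‿cong (-‿distribʳ-* x y) ⟨
    - - (x * y)   ≈⟨ -‿involutive _ ⟩
    x * y         ∎

  -- The double Laplace expansion along two equal rows x.  The terms choosing columns {0, k+1}
  -- in the two possible orders cancel; the others are the same sum for the tail of x.
  double-expansion : ∀ n (x : Row (suc (suc n))) (D : (Fin n → Fin (suc (suc n))) → Carrier) →
    (∀ {φ ψ} → (∀ s → φ s ≡ ψ s) → D φ ≈ D ψ) →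
    sumFin (suc (suc n)) (λ j → sumFin (suc n) (λ k →
      (sign (toℕ j) * sign (toℕ k)) * ((x j * x (punchIn j k)) * D (punchIn j ∘ punchIn k)))) ≈ 0#
  double-expansion n x D D-cong = begin
    sumFin (suc n) (T zero) + sumFin (suc n) (λ j → T (suc j) zero + rest j)
      ≈⟨ +-congˡ (sumFin-+ (suc n) (λ j → T (suc j) zero) rest) ⟩
    sumFin (suc n) (T zero) + (sumFin (suc n) (λ j → T (suc j) zero) + sumFin (suc n) rest)
      ≈⟨ +-assoc _ _ _ ⟨
    (sumFin (suc n) (T zero) + sumFin (suc n) (λ j → T (suc j) zero)) + sumFin (suc n) rest
      ≈⟨ +-congʳ (sumFin-+ (suc n) (T zero) (λ j → T (suc j) zero)) ⟨
    sumFin (suc n) (λ k → T zero k + T (suc k) zero) + sumFin (suc n) rest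
      ≈⟨ 0+0≈0 (sumFin-zero (suc n) cancel) (rest-vanishes n x D D-cong) ⟩
    0# ∎
    where
    T : Fin (suc (suc n)) → Fin (suc n) → Carrier
    T j k = (sign (toℕ j) * sign (toℕ k)) * ((x j * x (punchIn j k)) * D (punchIn j ∘ punchIn k))
    rest : Fin (suc n) → Carrier
    rest j = sumFin n (λ k → T (suc j) (suc k))
    cancel : ∀ k → T zero k + T (suc k) zero ≈ 0#
    cancel k = begin
      T zero k + T (suc k) zero
        ≈⟨ +-cong (*-cong (*-identityˡ _) refl)
             (*-cong (*-identityʳ _) (*-cong (*-comm _ _) (D-cong (λ _ → ≡.refl)))) ⟩
      σ * t + - σ * t    ≈⟨ +-congˡ (-‿distribˡ-* _ _) ⟨
      σ * t + - (σ * t)  ≈⟨ -‿inverseʳ _ ⟩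
      0#                 ∎
      where
      σ t : Carrier
      σ = sign (toℕ k)
      t = (x zero * x (suc k)) * D (suc ∘ punchIn k)
    -- Both signs flip, so their product is unchanged. Column 0 is never chosen, so it remains the
    -- first column of every minor, and `lift` absorbs it into the choice of columns. This is why
    -- `D` is an arbitrary function of that choice.
    rest-vanishes : ∀ n (x : Row (suc (suc n))) (D : (Fin n → Fin (suc (suc n))) → Carrier) →
      (∀ {φ ψ} → (∀ s → φ s ≡ ψ s) → D φ ≈ D ψ) →
      sumFin (suc n) (λ j → sumFin n (λ k →
        (- sign (toℕ j) * - sign (toℕ k)) * ((x (suc j) * x (suc (punchIn j k))) *
          D (punchIn (suc j) ∘ punchIn (suc k))))) ≈ 0#
    rest-vanishes zero    x D D-cong = sumFin-zero 1 (λ _ → refl)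
    rest-vanishes (suc n) x D D-cong = trans
      (sumFin-cong (suc (suc n)) {λ j → sumFin (suc n) (T′ j)} {λ j → sumFin (suc n) (T″ j)}
        (λ j → sumFin-cong (suc n) {T′ j} {T″ j} (λ k →
          *-cong (signs-cancel (sign (toℕ j)) (sign (toℕ k)))
            (*-congˡ {tail x j * tail x (punchIn j k)} (D-cong
              {punchIn (suc j) ∘ punchIn (suc k)} {lift (punchIn j ∘ punchIn k)}
              (λ { zero → ≡.refl ; (suc s) → ≡.refl }))))))
      (double-expansion n (tail x) (D ∘ lift)
        (λ p → D-cong (λ { zero → ≡.refl ; (suc s) → ≡.cong suc (p s) })))
      where
      lift : (Fin n → Fin (suc (suc n))) → Fin (suc n) → Fin (suc (suc (suc n)))
      lift φ zero    = zero
      lift φ (suc s) = suc (φ s)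
      T′ T″ : Fin (suc (suc n)) → Fin (suc n) → Carrier
      T′ j k = (- sign (toℕ j) * - sign (toℕ k)) * ((x (suc j) * x (suc (punchIn j k))) *
                 D (punchIn (suc j) ∘ punchIn (suc k)))
      T″ j k = (sign (toℕ j) * sign (toℕ k)) * ((tail x j * tail x (punchIn j k)) *
                 D (lift (punchIn j ∘ punchIn k)))

  -- Linearity in the first row is termwise. In the other rows the expansion is a combination of
  -- minors, alternating by induction after pulling back along the deletion of a column. Equality of
  -- the first two rows is handled by `double-expansion`.
  det-alternating : ∀ n → Alternating n (det n)
  det-alternating zero    p = refl
  det-alternating (suc n) =
    det-cong (suc n) ,
    (λ r → record
      { cong  = λ {x} {y} p → det-cong (suc n) {x ∷ r} {y ∷ r} (∷-≋ p (λ _ _ → refl))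
      ; add   = λ x y → trans
          (sumFin-cong (suc n)
            {laplace n ((x ⊕ y) ∷ r)} {λ j → laplace n (x ∷ r) j + laplace n (y ∷ r) j} (λ j →
            solve 4 (λ σ x y d → σ :* ((x :+ y) :* d) := σ :* (x :* d) :+ σ :* (y :* d))
              refl (sign (toℕ j)) (x j) (y j) (det n (minor r j))))
          (sumFin-+ (suc n) (laplace n (x ∷ r)) (laplace n (y ∷ r)))
      ; scale = λ a x → trans
          (sumFin-cong (suc n) {laplace n ((a ⊛ x) ∷ r)} {λ j → a * laplace n (x ∷ r) j} (λ j →
            solve 4 (λ σ a x d → σ :* ((a :* x) :* d) := a :* (σ :* (x :* d)))
              refl (sign (toℕ j)) a (x j) (det n (minor r j))))
          (sumFin-*ˡ (suc n) a (laplace n (x ∷ r))) }) ,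
    (λ x → Alternating-sum n (suc n) {λ j r → laplace n (x ∷ r) j} (λ j →
      Alternating-scale n (sign (toℕ j)) (Alternating-scale n (x j)
        (Alternating-map n (restrict j) (det-alternating n))))) ,
    repeat n
    where
    minor : Rows n (suc n) → Fin (suc n) → Fin n → Fin n → Carrier
    minor r j a s = r a (punchIn j s)
    restrict : ∀ {n} j → LinearMap (λ (x : Row (suc n)) → x ∘ punchIn j)
    restrict j = record
      { cong = λ p s → p (punchIn j s) ; add = λ _ _ _ → refl ; scale = λ _ _ _ → refl }
    repeat : ∀ n → VanishesOnRepeat n (det (suc n))
    repeat zero        = tt
    repeat (suc n) x r = trans
      (sumFin-cong (suc (suc n)) {laplace (suc n) (x ∷ x ∷ r)} {λ j → sumFin (suc n) (T j)} (λ j →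
        begin
          sign (toℕ j) * (x j * sumFin (suc n) (inner j))
            ≈⟨ *-assoc _ _ _ ⟨
          (sign (toℕ j) * x j) * sumFin (suc n) (inner j)
            ≈⟨ sumFin-*ˡ (suc n) (sign (toℕ j) * x j) (inner j) ⟨
          sumFin (suc n) (λ k → (sign (toℕ j) * x j) * inner j k)
            ≈⟨ sumFin-cong (suc n) {λ k → (sign (toℕ j) * x j) * inner j k} {T j} (λ k →
                 solve 5 (λ σ a τ b d → (σ :* a) :* (τ :* (b :* d)) := (σ :* τ) :* ((a :* b) :* d))
                   refl (sign (toℕ j)) (x j) (sign (toℕ k)) (x (punchIn j k))
                   (D (punchIn j ∘ punchIn k))) ⟩
          sumFin (suc n) (T j) ∎))
      (double-expansion n x D (λ p → det-cong n (λ a s → reflexive (≡.cong (r a) (p s)))))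
      where
      D : (Fin n → Fin (suc (suc n))) → Carrier
      D φ = det n (λ a s → r a (φ s))
      inner T : Fin (suc (suc n)) → Fin (suc n) → Carrier
      inner j k = sign (toℕ k) * (x (punchIn j k) * D (punchIn j ∘ punchIn k))
      T j k = (sign (toℕ j) * sign (toℕ k)) * ((x j * x (punchIn j k)) * D (punchIn j ∘ punchIn k))

  -- Multiplicativity and reversal of the index order.

  _⊠_ : ∀ {n} → Rows n n → Rows n n → Rows n n
  (X ⊠ Y) i j = sumFin _ (λ l → X i l * Y l j)

  -- As a function of `X`, det (XY) is alternating, hence det X times its value at the identity,
  -- which is det Y.
  det-⊠ : ∀ n (X Y : Rows n n) → det n (X ⊠ Y) ≈ det n X * det n Y
  det-⊠ n X Y = trans (alternating-det n (Alternating-map n apply (det-alternating n)) X)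
    (*-congˡ (det-cong n (λ i j → unit-sum n (λ l → Y l j) i)))
    where
    apply : LinearMap (λ x j → sumFin n (λ l → x l * Y l j))
    apply = record
      { cong  = λ p j → sumFin-cong n (λ l → *-congʳ (p l))
      ; add   = λ x y j → trans (sumFin-cong n (λ l → distribʳ _ _ _)) (sumFin-+ n _ _)
      ; scale = λ a x j → trans (sumFin-cong n (λ l → *-assoc _ _ _)) (sumFin-*ˡ n a _) }

  unit-refl : ∀ {n} (i : Fin n) → unit i i ≈ 1#
  unit-refl zero    = refl
  unit-refl (suc i) = unit-refl i

  unit-≢ : ∀ {n} {i j : Fin n} → ¬ i ≡ j → unit i j ≈ 0#
  unit-≢ {i = zero}  {zero}  p = contradiction ≡.refl p
  unit-≢ {i = zero}  {suc j} p = refl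
  unit-≢ {i = suc i} {zero}  p = refl
  unit-≢ {i = suc i} {suc j} p = unit-≢ (p ∘ ≡.cong suc)

  unit-opposite : ∀ {n} (i j : Fin n) → unit i (opposite j) ≈ unit (opposite i) j
  unit-opposite i j with i Fin.≟ opposite j
  ... | yes ≡.refl = trans (unit-refl (opposite j))
          (sym (trans (reflexive (≡.cong (λ k → unit k j) (opposite-involutive j))) (unit-refl j)))
  ... | no i≢ = trans (unit-≢ i≢)
          (sym (unit-≢ {i = opposite i} {j} (λ { ≡.refl → i≢ (≡.sym (opposite-involutive i)) })))

  det-unit : ∀ n → det n unit ≈ 1#
  det-unit zero    = refl
  det-unit (suc n) = trans
    (+-cong (trans (*-identityˡ _) (*-identityˡ _))
            (sumFin-zero n (λ j → *-zero {sign (suc (toℕ j))} (zeroˡ _))))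
    (trans (+-identityʳ _) (det-unit n))

  -- The reversed matrix is JMJ for the reversal permutation `J`. Since JJ is the identity, det J
  -- occurs only squared and its sign need not be computed.
  det-opposite : ∀ n (M : Rows n n) → det n (λ i j → M (opposite i) (opposite j)) ≈ det n M
  det-opposite n M = begin
    det n (λ i j → M (opposite i) (opposite j))
      ≈⟨ det-cong n (λ i j → unit-sum n (λ l → M l (opposite j)) (opposite i)) ⟨
    det n (J ⊠ (λ l j → M l (opposite j)))
      ≈⟨ det-⊠ n J _ ⟩
    det n J * det n (λ i j → M i (opposite j))
      ≈⟨ *-congˡ (det-cong n (λ i j → trans
           (sumFin-cong n (λ l → *-congˡ (sym (unit-opposite l j)))) (sum-unit n (M i) (opposite j)))) ⟨
    det n J * det n (M ⊠ J)
      ≈⟨ *-congˡ (det-⊠ n M J) ⟩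
    det n J * (det n M * det n J)
      ≈⟨ solve 2 (λ j m → j :* (m :* j) := (j :* j) :* m) refl _ _ ⟩
    (det n J * det n J) * det n M
      ≈⟨ *-congʳ (det-⊠ n J J) ⟨
    det n (J ⊠ J) * det n M
      ≈⟨ *-congʳ (det-cong n (λ i j → trans (unit-sum n (λ l → J l j) (opposite i))
           (reflexive (≡.cong (λ k → unit k j) (opposite-involutive i))))) ⟩
    det n unit * det n M
      ≈⟨ trans (*-congʳ (det-unit n)) (*-identityˡ _) ⟩
    det n M ∎
    where
    J : Rows n n
    J i = unit (opposite i)

  -- Block triangular determinants.

  punchIn-↑ˡ : ∀ {k} m (j : Fin (suc k)) (i : Fin k) →
               punchIn (j ↑ˡ m) (i ↑ˡ m) ≡ punchIn j i ↑ˡ m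
  punchIn-↑ˡ m zero    i       = ≡.refl
  punchIn-↑ˡ m (suc j) zero    = ≡.refl
  punchIn-↑ˡ m (suc j) (suc i) = ≡.cong suc (punchIn-↑ˡ m j i)

  punchIn-↑ʳ : ∀ k {m} (j : Fin (suc k)) (i : Fin m) → punchIn (j ↑ˡ m) (k ↑ʳ i) ≡ suc k ↑ʳ i
  punchIn-↑ʳ k       zero    i = ≡.refl
  punchIn-↑ʳ (suc k) (suc j) i = ≡.cong suc (punchIn-↑ʳ k j i)

  -- Induction on `k` by expansion along the first row: only the first `k` columns contribute, and
  -- deleting one of them leaves the zero block and the lower right block intact.
  det-block : ∀ k m (M : Rows (k ℕ.+ m) (k ℕ.+ m)) →
    (∀ i j → M (i ↑ˡ m) (k ↑ʳ j) ≈ 0#) →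
    det (k ℕ.+ m) M ≈
      det k (λ i j → M (i ↑ˡ m) (j ↑ˡ m)) * det m (λ i j → M (k ↑ʳ i) (k ↑ʳ j))
  det-block zero    m M z = sym (*-identityˡ _)
  det-block (suc k) m M z = begin
    det (suc k ℕ.+ m) M
      ≈⟨ sumFin-↑ (suc k) m (laplace (k ℕ.+ m) M) ⟩
    sumFin (suc k) (λ j → laplace (k ℕ.+ m) M (j ↑ˡ m)) +
    sumFin m (λ j → laplace (k ℕ.+ m) M (suc k ↑ʳ j))
      ≈⟨ +-cong
           (sumFin-cong (suc k) {λ j → laplace (k ℕ.+ m) M (j ↑ˡ m)} {λ j → laplace k B j * det m D} left)
           (sumFin-zero m {λ j → laplace (k ℕ.+ m) M (suc k ↑ʳ j)}
             (λ j → *-zero {sign (toℕ (suc k ↑ʳ j))} (zero-* (z zero j)))) ⟩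
    sumFin (suc k) (λ j → laplace k B j * det m D) + 0#
      ≈⟨ +-identityʳ _ ⟩
    sumFin (suc k) (λ j → laplace k B j * det m D)
      ≈⟨ sumFin-*ʳ (suc k) (det m D) (laplace k B) ⟩
    det (suc k) B * det m D ∎
    where
    B : Rows (suc k) (suc k)
    B i j = M (i ↑ˡ m) (j ↑ˡ m)
    D : Rows m m
    D i j = M (suc k ↑ʳ i) (suc k ↑ʳ j)
    minor : Fin (suc k) → Rows (k ℕ.+ m) (k ℕ.+ m)
    minor j r s = M (suc r) (punchIn (j ↑ˡ m) s)
    left : ∀ j → laplace (k ℕ.+ m) M (j ↑ˡ m) ≈ laplace k B j * det m D
    left j = begin
      sign (toℕ (j ↑ˡ m)) * (M zero (j ↑ˡ m) * det (k ℕ.+ m) (minor j))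
        ≈⟨ *-cong (reflexive (≡.cong sign (toℕ-↑ˡ j m))) (*-congˡ (trans
             (det-block k m (minor j) (λ r s → trans
               (reflexive (≡.cong (M (suc r ↑ˡ m)) (punchIn-↑ʳ k j s))) (z (suc r) s)))
             (*-cong
               (det-cong k (λ r s → reflexive (≡.cong (M (suc r ↑ˡ m)) (punchIn-↑ˡ m j s))))
               (det-cong m (λ r s → reflexive (≡.cong (M (suc k ↑ʳ r)) (punchIn-↑ʳ k j s))))))) ⟩
      sign (toℕ j) * (B zero j * (det k (λ r s → B (suc r) (punchIn j s)) * det m D))
        ≈⟨ solve 4 (λ a b c d → a :* (b :* (c :* d)) := (a :* (b :* c)) :* d) refl _ _ _ _ ⟩
      laplace k B j * det m D ∎

  -- Determinants of matrices indexed by natural numbers.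

  Matrix : Set c
  Matrix = ℕ → ℕ → Carrier

  Σ< : ℕ → (ℕ → Carrier) → Carrier
  Σ< n f = sumFin n (λ i → f (toℕ i))

  Σ<-zero : ∀ n {f : ℕ → Carrier} → (∀ i → i < n → f i ≈ 0#) → Σ< n f ≈ 0#
  Σ<-zero n p = sumFin-zero n (λ i → p (toℕ i) (toℕ<n i))

  detℕ : ℕ → Matrix → Carrier
  detℕ n f = det n (λ i j → f (toℕ i) (toℕ j))

  detℕ-cong : ∀ n {f g : Matrix} → (∀ i j → i < n → j < n → f i j ≈ g i j) → detℕ n f ≈ detℕ n g
  detℕ-cong n p = det-cong n (λ i j → p (toℕ i) (toℕ j) (toℕ<n i) (toℕ<n j))

  _⊠[_]_ : Matrix → ℕ → Matrix → Matrix
  (f ⊠[ n ] g) i j = Σ< n (λ l → f i l * g l j)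

  detℕ-⊠ : ∀ n f g → detℕ n (f ⊠[ n ] g) ≈ detℕ n f * detℕ n g
  detℕ-⊠ n f g = det-⊠ n (λ i j → f (toℕ i) (toℕ j)) (λ i j → g (toℕ i) (toℕ j))

  detℕ-reverse : ∀ n f → detℕ n (λ i j → f (n ∸ suc i) (n ∸ suc j)) ≈ detℕ n f
  detℕ-reverse n f = trans
    (det-cong n (λ i j → reflexive (≡.sym (≡.cong₂ f (opposite-prop i) (opposite-prop j)))))
    (det-opposite n (λ i j → f (toℕ i) (toℕ j)))

  detℕ-lower-block : ∀ k m f → (∀ i j → i < k → j < m → f i (k ℕ.+ j) ≈ 0#) →
    detℕ (k ℕ.+ m) f ≈ detℕ k f * detℕ m (λ i j → f (k ℕ.+ i) (k ℕ.+ j))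
  detℕ-lower-block k m f z = trans
    (det-block k m (λ i j → f (toℕ i) (toℕ j)) (λ i j → trans
      (reflexive (≡.cong₂ f (toℕ-↑ˡ i m) (toℕ-↑ʳ k j))) (z (toℕ i) (toℕ j) (toℕ<n i) (toℕ<n j))))
    (*-cong
      (det-cong k (λ i j → reflexive (≡.cong₂ f (toℕ-↑ˡ i m) (toℕ-↑ˡ j m))))
      (det-cong m (λ i j → reflexive (≡.cong₂ f (toℕ-↑ʳ k i) (toℕ-↑ʳ k j)))))

  -- Reversing both index orders exchanges the two diagonal blocks and moves the zero block to the
  -- upper right, where `detℕ-lower-block` applies.
  detℕ-upper-block : ∀ k m f → (∀ i j → i < m → j < k → f (k ℕ.+ i) j ≈ 0#) →
    detℕ (k ℕ.+ m) f ≈ detℕ k f * detℕ m (λ i j → f (k ℕ.+ i) (k ℕ.+ j))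
  detℕ-upper-block k m f z = begin
    detℕ (k ℕ.+ m) f
      ≈⟨ detℕ-reverse (k ℕ.+ m) f ⟨
    detℕ (k ℕ.+ m) f′
      ≈⟨ reflexive (≡.cong (λ n → detℕ n f′) (ℕ.+-comm k m)) ⟩
    detℕ (m ℕ.+ k) f′
      ≈⟨ detℕ-lower-block m k f′ (λ i j i<m j<k → trans
           (reflexive (≡.cong₂ f (top i i<m) (bottom j))) (z _ _ (∸-suc-< i<m) (∸-suc-< j<k))) ⟩
    detℕ m f′ * detℕ k (λ i j → f′ (m ℕ.+ i) (m ℕ.+ j))
      ≈⟨ *-cong
           (detℕ-cong m (λ i j p q → reflexive (≡.cong₂ f (top i p) (top j q))))
           (detℕ-cong k (λ i j p q → reflexive (≡.cong₂ f (bottom i) (bottom j)))) ⟩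
    detℕ m (λ i j → f (k ℕ.+ (m ∸ suc i)) (k ℕ.+ (m ∸ suc j))) *
    detℕ k (λ i j → f (k ∸ suc i) (k ∸ suc j))
      ≈⟨ *-cong (detℕ-reverse m (λ i j → f (k ℕ.+ i) (k ℕ.+ j))) (detℕ-reverse k f) ⟩
    detℕ m (λ i j → f (k ℕ.+ i) (k ℕ.+ j)) * detℕ k f
      ≈⟨ *-comm _ _ ⟩
    detℕ k f * detℕ m (λ i j → f (k ℕ.+ i) (k ℕ.+ j)) ∎
    where
    f′ : Matrix
    f′ i j = f (k ℕ.+ m ∸ suc i) (k ℕ.+ m ∸ suc j)
    ∸-suc-< : ∀ {n i} → i < n → n ∸ suc i < n
    ∸-suc-< {suc n} {i} _ = s≤s (ℕ.m∸n≤m n i)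
    top : ∀ i → i < m → k ℕ.+ m ∸ suc i ≡ k ℕ.+ (m ∸ suc i)
    top i i<m = ℕ.+-∸-assoc k i<m
    bottom : ∀ i → k ℕ.+ m ∸ suc (m ℕ.+ i) ≡ k ∸ suc i
    bottom i = ≡.trans (≡.cong₂ _∸_ (ℕ.+-comm k m) (≡.sym (ℕ.+-suc m i))) (ℕ.[m+n]∸[m+o]≡n∸o m k (suc i))

  prodRange-cong : ∀ n {f g : ℕ → Carrier} → (∀ i → i < n → f i ≈ g i) →
                   prodRange n f ≈ prodRange n g
  prodRange-cong zero    p = refl
  prodRange-cong (suc n) p = *-cong (prodRange-cong n (λ i i<n → p i (ℕ.m<n⇒m<1+n i<n))) (p n ℕ.≤-refl)

  prodRange-head : ∀ n f → prodRange (suc n) f ≈ f 0 * prodRange n (f ∘ suc)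
  prodRange-head zero    f = *-comm _ _
  prodRange-head (suc n) f = trans (*-congʳ (prodRange-head n f)) (*-assoc _ _ _)

  prodRange-reverse : ∀ n f → prodRange n (λ i → f (n ∸ suc i)) ≈ prodRange n f
  prodRange-reverse zero    f = refl
  prodRange-reverse (suc n) f = begin
    prodRange (suc n) (λ i → f (n ∸ i))       ≈⟨ prodRange-head n (λ i → f (n ∸ i)) ⟩
    f n * prodRange n (λ i → f (n ∸ suc i))   ≈⟨ *-congˡ (prodRange-reverse n f) ⟩
    f n * prodRange n f                       ≈⟨ *-comm _ _ ⟩
    prodRange n f * f n                       ∎

  detℕ-lower-triangular : ∀ n f → (∀ i j → i < j → j < n → f i j ≈ 0#) →
                          detℕ n f ≈ prodRange n (λ i → f i i)
  detℕ-lower-triangular zero    f z = refl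
  detℕ-lower-triangular (suc n) f z = begin
    detℕ (suc n) f
      ≈⟨ +-cong (*-identityˡ _) (sumFin-zero n (λ j →
           *-zero {sign (suc (toℕ j))} (zero-* (z 0 _ (s≤s z≤n) (s≤s (toℕ<n j)))))) ⟩
    f 0 0 * detℕ n (λ i j → f (suc i) (suc j)) + 0#
      ≈⟨ +-identityʳ _ ⟩
    f 0 0 * detℕ n (λ i j → f (suc i) (suc j))
      ≈⟨ *-congˡ (detℕ-lower-triangular n (λ i j → f (suc i) (suc j))
                    (λ i j p q → z (suc i) (suc j) (s≤s p) (s≤s q))) ⟩
    f 0 0 * prodRange n (λ i → f (suc i) (suc i))
      ≈⟨ prodRange-head n (λ i → f i i) ⟨
    prodRange (suc n) (λ i → f i i) ∎

  detℕ-upper-triangular : ∀ n f → (∀ i j → j < i → i < n → f i j ≈ 0#) →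
                          detℕ n f ≈ prodRange n (λ i → f i i)
  detℕ-upper-triangular n f z = begin
    detℕ n f                                           ≈⟨ detℕ-reverse n f ⟨
    detℕ n (λ i j → f (n ∸ suc i) (n ∸ suc j))
      ≈⟨ detℕ-lower-triangular n _ (λ i j i<j j<n →
           z _ _ (ℕ.∸-monoʳ-< (s≤s i<j) j<n) (ℕ.∸-monoʳ-< {n} {suc i} {0} (s≤s z≤n) (ℕ.<-trans i<j j<n))) ⟩
    prodRange n (λ i → f (n ∸ suc i) (n ∸ suc i))      ≈⟨ prodRange-reverse n (λ i → f i i) ⟩
    prodRange n (λ i → f i i)                          ∎

-- Three-term sums, spliced sequences and cancellation.

module TridiagonalMatrices {c ℓ : Level} (F : Field c ℓ) where
  open Determinants F public

  previous : (ℕ → Carrier) → ℕ → Carrier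
  previous f zero    = 0#
  previous f (suc i) = f i

  -- The three-term shape is kept at both ends of the range: `previous` supplies 0 at the left end,
  -- and at the right end the term at i+1, which lies outside the sum, is required to be 0 by
  -- `edge`.
  Σ<-near : ∀ n i f → i < n →
    (∀ l → suc l < i → f l ≈ 0#) → (∀ l → suc i < l → f l ≈ 0#) → (n ≤ suc i → f (suc i) ≈ 0#) →
    Σ< n f ≈ (previous f i + f i) + f (suc i)
  Σ<-near (suc zero) zero f i<n low high edge = trans
    (+-cong (sym (+-identityˡ _)) (sym (edge ℕ.≤-refl))) refl
  Σ<-near (suc (suc n)) zero f i<n low high edge =
    trans (+-congˡ (trans (+-congˡ (Σ<-zero n (λ i _ → high (suc (suc i)) (s≤s (s≤s z≤n))))) (+-identityʳ _)))
          (+-congʳ (sym (+-identityˡ _)))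
  Σ<-near (suc n) (suc i) f (s≤s i<n) low high edge = begin
    f 0 + Σ< n (f ∘ suc)
      ≈⟨ +-congˡ (Σ<-near n i (f ∘ suc) i<n (λ l p → low _ (s≤s p)) (λ l p → high _ (s≤s p))
           (λ p → edge (s≤s p))) ⟩
    f 0 + ((previous (f ∘ suc) i + f (suc i)) + f (suc (suc i)))
      ≈⟨ solve 4 (λ a b c d → a :+ ((b :+ c) :+ d) := ((a :+ b) :+ c) :+ d) refl _ _ _ _ ⟩
    ((f 0 + previous (f ∘ suc) i) + f (suc i)) + f (suc (suc i))
      ≈⟨ +-congʳ (+-congʳ (shift i low)) ⟩
    (f i + f (suc i)) + f (suc (suc i)) ∎
    where
    shift : ∀ i → (∀ l → suc l < suc i → f l ≈ 0#) → f 0 + previous (f ∘ suc) i ≈ f i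
    shift zero    low = +-identityʳ _
    shift (suc i) low = trans (+-congʳ (low 0 (s≤s (s≤s z≤n)))) (+-identityˡ _)

  append : ∀ {a} {A : Set a} → ℕ → (ℕ → A) → (ℕ → A) → ℕ → A
  append zero    f g i       = g i
  append (suc k) f g zero    = f zero
  append (suc k) f g (suc i) = append k (f ∘ suc) g i

  append-< : ∀ {a} {A : Set a} k {f g : ℕ → A} {i} → i < k → append k f g i ≡ f i
  append-< (suc k) {i = zero}  _         = ≡.refl
  append-< (suc k) {i = suc i} (s≤s i<k) = append-< k i<k

  append-+ : ∀ {a} {A : Set a} k {f g : ℕ → A} i → append k f g (k ℕ.+ i) ≡ g i
  append-+ zero    i = ≡.refl
  append-+ (suc k) i = append-+ k i

  append-lift : ∀ {a r} {A : Set a} (R : A → A → Set r) k {f f′ g g′ : ℕ → A} →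
    (∀ i → R (f i) (f′ i)) → (∀ i → R (g i) (g′ i)) → ∀ i → R (append k f g i) (append k f′ g′ i)
  append-lift R zero    p q i       = q i
  append-lift R (suc k) p q zero    = p zero
  append-lift R (suc k) p q (suc i) = append-lift R k (p ∘ suc) q i

  prodRange-1 : ∀ n {f} → (∀ i → i < n → f i ≈ 1#) → prodRange n f ≈ 1#
  prodRange-1 zero    p = refl
  prodRange-1 (suc n) p = trans
    (*-cong (prodRange-1 n (λ i i<n → p i (ℕ.m<n⇒m<1+n i<n))) (p n ℕ.≤-refl)) (*-identityˡ _)

  prodRange-const : ∀ n {f} x → (∀ i → i < n → f i ≈ x) → prodRange n f ≈ pow x n
  prodRange-const zero    x p = refl
  prodRange-const (suc n) x p = trans
    (*-cong (prodRange-const n x (λ i i<n → p i (ℕ.m<n⇒m<1+n i<n))) (p n ℕ.≤-refl)) (*-comm _ _)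

  δ : ℕ → ℕ → Carrier
  δ zero    zero    = 1#
  δ zero    (suc j) = 0#
  δ (suc i) zero    = 0#
  δ (suc i) (suc j) = δ i j

  δ-refl : ∀ i → δ i i ≈ 1#
  δ-refl zero    = refl
  δ-refl (suc i) = δ-refl i

  δ-≢ : ∀ {i j} → ¬ i ≡ j → δ i j ≈ 0#
  δ-≢ {zero}  {zero}  p = contradiction ≡.refl p
  δ-≢ {zero}  {suc j} p = refl
  δ-≢ {suc i} {zero}  p = refl
  δ-≢ {suc i} {suc j} p = δ-≢ (p ∘ ≡.cong suc)

  Σ<-δ : ∀ n {k} (f : ℕ → Carrier) → k < n → Σ< n (λ l → f l * δ k l) ≈ f k
  Σ<-δ (suc n) {zero}  f _ = trans
    (+-cong (*-identityʳ _) (Σ<-zero n {λ l → f (suc l) * 0#} (λ _ _ → zeroʳ _))) (+-identityʳ _)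
  Σ<-δ (suc n) {suc k} f (s≤s k<n) = trans (+-cong (zeroʳ _) (Σ<-δ n (f ∘ suc) k<n)) (+-identityˡ _)

  sumRange-cong : ∀ n {f g : ℕ → Carrier} → (∀ i → i < n → f i ≈ g i) → sumRange n f ≈ sumRange n g
  sumRange-cong zero    p = refl
  sumRange-cong (suc n) p =
    +-cong (sumRange-cong n (λ i i<n → p i (ℕ.m<n⇒m<1+n i<n))) (p n ℕ.≤-refl)

  sumRange-zero : ∀ n {f : ℕ → Carrier} → (∀ i → i < n → f i ≈ 0#) → sumRange n f ≈ 0#
  sumRange-zero zero    p = refl
  sumRange-zero (suc n) p =
    0+0≈0 (sumRange-zero n (λ i i<n → p i (ℕ.m<n⇒m<1+n i<n))) (p n ℕ.≤-refl)

  sumRange-+ : ∀ n (f g : ℕ → Carrier) →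
               sumRange n (λ i → f i + g i) ≈ sumRange n f + sumRange n g
  sumRange-+ zero    f g = sym (+-identityˡ 0#)
  sumRange-+ (suc n) f g = trans (+-congʳ (sumRange-+ n f g))
    (solve 4 (λ a b x y → (a :+ b) :+ (x :+ y) := (a :+ x) :+ (b :+ y)) refl _ _ _ _)

  sumRange-*ˡ : ∀ n a (f : ℕ → Carrier) → sumRange n (λ i → a * f i) ≈ a * sumRange n f
  sumRange-*ˡ zero    a f = sym (zeroʳ a)
  sumRange-*ˡ (suc n) a f = trans (+-congʳ (sumRange-*ˡ n a f)) (sym (distribˡ a _ _))

  -- An explicit reciprocal replaces a proof of x ≉ 0, so that products and powers of nonzero
  -- elements can be cancelled by the product or power of their inverses.
  cancel-inverse : ∀ {x r} → x * r ≈ 1# → ∀ {y z} → x * y ≈ x * z → y ≈ z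
  cancel-inverse {x} {r} xr {y} {z} e = begin
    y            ≈⟨ expand y ⟩
    r * (x * y)  ≈⟨ *-congˡ e ⟩
    r * (x * z)  ≈⟨ expand z ⟨
    z            ∎
    where
    expand : ∀ y → y ≈ r * (x * y)
    expand y = trans (sym (trans (*-congʳ xr) (*-identityˡ y)))
      (solve 3 (λ x r y → (x :* r) :* y := r :* (x :* y)) refl x r y)

  cancel-nonzero : ∀ {x y} → ¬ x ≈ 0# → x * y ≈ 0# → y ≈ 0#
  cancel-nonzero {x} x≉0 e = cancel-inverse (Field.inverse F x x≉0) (trans e (sym (zeroʳ x)))

  add-back : ∀ x a y → a * y + (x + - a * y) ≈ x
  add-back x a y = begin
    a * y + (x + - a * y)    ≈⟨ +-congˡ (+-congˡ (sym (-‿distribˡ-* a y))) ⟩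
    a * y + (x + - (a * y))  ≈⟨ solve 3 (λ u x v → u :+ (x :+ v) := x :+ (u :+ v)) refl _ _ _ ⟩
    x + (a * y + - (a * y))  ≈⟨ +-congˡ (-‿inverseʳ _) ⟩
    x + 0#                   ≈⟨ +-identityʳ x ⟩
    x                        ∎

  ⊖-cancel : ∀ c q r → (c ℕ.+ q) ℤ.⊖ r ℤ.- + c ≡ q ℤ.⊖ r
  ⊖-cancel c q r = ≡.trans (≡.cong (ℤ._- + c) (≡.sym (ℤ.m-n≡m⊖n (c ℕ.+ q) r)))
    (≡.trans (regroup (+ c) (+ q) (+ r)) (ℤ.m-n≡m⊖n q r))
    where
    regroup : ∀ c q r → ((c ℤ.+ q) ℤ.- r) ℤ.- c ≡ q ℤ.- r
    regroup = solve-∀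

  -- The tridiagonal matrix and its action on rows and columns.

  module Tridiagonal (b lam : ℕ → Carrier) where
    open FieldDefs F using (triEntry)

    entry : Matrix
    entry = triEntry b lam

    entry-diagonal : ∀ i → entry i i ≡ b i
    entry-diagonal i rewrite dec-true (i ℕ.≟ i) ≡.refl = ≡.refl

    entry-above : ∀ i → entry i (suc i) ≡ 1#
    entry-above i
      rewrite dec-false (i ℕ.≟ suc i) (ℕ.<⇒≢ ℕ.≤-refl)
            | dec-true (i ℕ.≟ i) ≡.refl = ≡.refl

    entry-below : ∀ i → entry (suc i) i ≡ lam (suc i)
    entry-below i
      rewrite dec-false (suc i ℕ.≟ i) (ℕ.>⇒≢ ℕ.≤-refl)
            | dec-false (suc (suc i) ℕ.≟ i) (ℕ.>⇒≢ (ℕ.m<n⇒m<1+n ℕ.≤-refl))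
            | dec-true (i ℕ.≟ i) ≡.refl = ≡.refl

    entry-far : ∀ {i j} → ¬ i ≡ j → ¬ suc i ≡ j → ¬ i ≡ suc j → entry i j ≡ 0#
    entry-far {i} {j} p q r
      rewrite dec-false (i ℕ.≟ j) p
            | dec-false (suc i ℕ.≟ j) q
            | dec-false (i ℕ.≟ suc j) r = ≡.refl

    entry-far-< : ∀ {i j} → suc i < j → entry i j ≡ 0#
    entry-far-< p = entry-far (ℕ.<⇒≢ (ℕ.<-trans ℕ.≤-refl p)) (ℕ.<⇒≢ p)
      (ℕ.<⇒≢ (ℕ.<-trans ℕ.≤-refl (ℕ.m<n⇒m<1+n p)))

    entry-far-> : ∀ {i j} → suc j < i → entry i j ≡ 0#
    entry-far-> p = entry-far (ℕ.>⇒≢ (ℕ.<-trans ℕ.≤-refl p))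
      (ℕ.>⇒≢ (ℕ.<-trans ℕ.≤-refl (ℕ.m<n⇒m<1+n p))) (ℕ.>⇒≢ p)

    column-step : ∀ n {i} (y : ℕ → Carrier) → i < n → (n ≤ suc i → y (suc i) ≈ 0#) →
      Σ< n (λ l → entry i l * y l) ≈
        (previous (λ l → lam (suc l) * y l) i + b i * y i) + y (suc i)
    column-step n {i} y i<n edge = trans
      (Σ<-near n i (λ l → entry i l * y l) i<n
        (λ l p → zero-* (reflexive (entry-far-> p))) (λ l p → zero-* (reflexive (entry-far-< p)))
        (*-zero ∘ edge))
      (+-cong (+-cong (below i) (*-congʳ (reflexive (entry-diagonal i))))
              (trans (*-congʳ (reflexive (entry-above i))) (*-identityˡ _)))
      where
      below : ∀ i → previous (λ l → entry i l * y l) i ≈ previous (λ l → lam (suc l) * y l) i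
      below zero    = refl
      below (suc i) = *-congʳ (reflexive (entry-below i))

    row-step : ∀ n {j} (x : ℕ → Carrier) → j < n → (n ≤ suc j → x (suc j) ≈ 0#) →
      Σ< n (λ l → x l * entry l j) ≈ (previous x j + x j * b j) + x (suc j) * lam (suc j)
    row-step n {j} x j<n edge = trans
      (Σ<-near n j (λ l → x l * entry l j) j<n
        (λ l p → *-zero (reflexive (entry-far-< p))) (λ l p → *-zero (reflexive (entry-far-> p)))
        (zero-* ∘ edge))
      (+-cong (+-cong (above j) (*-congˡ (reflexive (entry-diagonal j))))
              (*-congˡ (reflexive (entry-below j))))
      where
      above : ∀ j → previous (λ l → x l * entry l j) j ≈ previous x j
      above zero    = refl
      above (suc j) = trans (*-congˡ (reflexive (entry-above j))) (*-identityʳ _)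

    -- A relation between consecutive times rather than powers of A applied to a starting vector:
    -- such a sequence may be known at a late time only, so its earlier terms represent negative
    -- powers of A.
    IsRowOrbit IsColumnOrbit : ℕ → (ℕ → ℕ → Carrier) → Set ℓ
    IsRowOrbit    n x = ∀ N j → j < n → x (suc N) j ≈ Σ< n (λ l → x N l * entry l j)
    IsColumnOrbit n y = ∀ N i → i < n → y (suc N) i ≈ Σ< n (λ l → entry i l * y N l)

    rowOrbit columnOrbit : ℕ → (ℕ → Carrier) → ℕ → ℕ → Carrier
    rowOrbit n x zero      = x
    rowOrbit n x (suc N) j = Σ< n (λ l → rowOrbit n x N l * entry l j)
    columnOrbit n y zero      = y
    columnOrbit n y (suc N) i = Σ< n (λ l → entry i l * columnOrbit n y N l)

    pairing : ℕ → (ℕ → Carrier) → (ℕ → Carrier) → Carrier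
    pairing n x y = Σ< n (λ l → x l * y l)

    pairing-adjoint : ∀ n (x y : ℕ → Carrier) →
      pairing n (λ j → Σ< n (λ l → x l * entry l j)) y ≈
      pairing n x (λ i → Σ< n (λ l → entry i l * y l))
    pairing-adjoint n x y = begin
      Σ< n (λ j → Σ< n (λ l → x l * entry l j) * y j)
        ≈⟨ sumFin-cong n (λ j → sumFin-*ʳ n (y (toℕ j)) _) ⟨
      Σ< n (λ j → Σ< n (λ l → (x l * entry l j) * y j))
        ≈⟨ sumFin-swap n n _ ⟩
      Σ< n (λ l → Σ< n (λ j → (x l * entry l j) * y j))
        ≈⟨ sumFin-cong n (λ l → trans (sumFin-cong n (λ j → *-assoc _ _ _))
             (sumFin-*ˡ n (x (toℕ l)) _)) ⟩
      Σ< n (λ l → x l * Σ< n (λ j → entry l j * y j)) ∎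

    -- Associativity of (x A^i) y = x (A^i y), phrased for orbits.
    pairing-shift : ∀ n {x y} → IsRowOrbit n x → IsColumnOrbit n y →
      ∀ i N l → pairing n (x (i ℕ.+ N)) (y l) ≈ pairing n (x N) (y (i ℕ.+ l))
    pairing-shift n row col zero    N l = refl
    pairing-shift n {x} {y} row col (suc i) N l = begin
      pairing n (x (suc i ℕ.+ N)) (y l)
        ≈⟨ sumFin-cong n (λ j → *-congʳ (row (i ℕ.+ N) (toℕ j) (toℕ<n j))) ⟩
      pairing n (λ j → Σ< n (λ l → x (i ℕ.+ N) l * entry l j)) (y l)
        ≈⟨ pairing-adjoint n (x (i ℕ.+ N)) (y l) ⟩
      pairing n (x (i ℕ.+ N)) (λ i → Σ< n (λ j → entry i j * y l j))
        ≈⟨ sumFin-cong n (λ j → *-congˡ (col l (toℕ j) (toℕ<n j))) ⟨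
      pairing n (x (i ℕ.+ N)) (y (suc l))
        ≈⟨ pairing-shift n {x} {y} row col i N (suc l) ⟩
      pairing n (x N) (y (i ℕ.+ suc l))
        ≈⟨ reflexive (≡.cong (λ s → pairing n (x N) (y s)) (ℕ.+-suc i l)) ⟩
      pairing n (x N) (y (suc i ℕ.+ l)) ∎

    pairing-δˡ : ∀ n {k} (y : ℕ → Carrier) → k < n → pairing n (δ k) y ≈ y k
    pairing-δˡ n y k<n = trans (sumFin-cong n (λ l → *-comm _ _)) (Σ<-δ n y k<n)

    -- The weight of the only path of `h` steps from height `h` to height 0.
    Λ : ℕ → Carrier
    Λ h = prodRange h (λ i → lam (suc i))

    module _ (n : ℕ) {y : ℕ → ℕ → Carrier} (orbit : IsColumnOrbit n y)
             (start : ∀ h → y 0 h ≈ δ 0 h) (cut : ∀ N → y N n ≈ 0#) where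

      -- Each application of A extends the support of e₀ by at most one index. The index `n` just
      -- past the end is included because it occurs as the edge term of `column-step`.
      columns-vanish : ∀ N {h} → N < h → h ≤ n → y N h ≈ 0#
      columns-vanish zero    {suc h} _ _ = start (suc h)
      columns-vanish (suc N) {suc h} (s≤s N<h) h<n with suc h ℕ.≟ n
      ... | yes ≡.refl = cut (suc N)
      ... | no h≢n = trans (orbit N (suc h) h<n′) (trans
              (column-step n (y N) h<n′ (λ _ → columns-vanish N (ℕ.m<n⇒m<1+n N<1+h) h<n′))
              (0+0≈0 (0+0≈0 (*-zero (columns-vanish N N<h (ℕ.<⇒≤ h<n)))
                            (*-zero (columns-vanish N N<1+h h<n)))
                     (columns-vanish N (ℕ.m<n⇒m<1+n N<1+h) h<n′)))
        where
        h<n′ : suc h < n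
        h<n′ = ℕ.≤∧≢⇒< h<n h≢n
        N<1+h : N < suc h
        N<1+h = ℕ.m<n⇒m<1+n N<h

      columns-diagonal : ∀ h → h < n → y h h ≈ Λ h
      columns-diagonal zero    _   = start 0
      columns-diagonal (suc h) h<n = begin
        y (suc h) (suc h)
          ≈⟨ orbit h (suc h) h<n ⟩
        Σ< n (λ l → entry (suc h) l * y h l)
          ≈⟨ column-step n (y h) h<n (λ _ → far) ⟩
        (lam (suc h) * y h h + b (suc h) * y h (suc h)) + y h (suc (suc h))
          ≈⟨ +-cong (+-cong (*-congˡ (columns-diagonal h (ℕ.<⇒≤ h<n)))
                            (*-zero (columns-vanish h ℕ.≤-refl (ℕ.<⇒≤ h<n)))) far ⟩
        (lam (suc h) * Λ h + 0#) + 0#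
          ≈⟨ trans (+-identityʳ _) (trans (+-identityʳ _) (*-comm _ _)) ⟩
        Λ (suc h) ∎
        where
        far : y h (suc (suc h)) ≈ 0#
        far = columns-vanish h (ℕ.m<n⇒m<1+n ℕ.≤-refl) h<n

    -- The mirror image: the support of e_K moves towards 0 by at most one index per step.
    last-columns-vanish : ∀ K N h → N ℕ.+ h < K → columnOrbit (suc K) (δ K) N h ≈ 0#
    last-columns-vanish K zero    h p = δ-≢ (ℕ.>⇒≢ p)
    last-columns-vanish K (suc N) h p = trans
      (column-step (suc K) (columnOrbit (suc K) (δ K) N) h<1+K (λ _ → next))
      (0+0≈0 (0+0≈0 (before h p) (*-zero (last-columns-vanish K N h (ℕ.<⇒≤ p)))) next)
      where
      h<1+K : h < suc K
      h<1+K = s≤s (ℕ.≤-trans (ℕ.m≤n+m h (suc N)) (ℕ.<⇒≤ p))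
      next : columnOrbit (suc K) (δ K) N (suc h) ≈ 0#
      next = last-columns-vanish K N (suc h) (≡.subst (_< K) (≡.sym (ℕ.+-suc N h)) p)
      before : ∀ h → suc N ℕ.+ h < K →
               previous (λ l → lam (suc l) * columnOrbit (suc K) (δ K) N l) h ≈ 0#
      before zero    p = refl
      before (suc h) p = *-zero (last-columns-vanish K N h
        (ℕ.<-trans (ℕ.+-monoʳ-< N (ℕ.n<1+n h)) (ℕ.<⇒≤ p)))

    -- The frontier of the support advances through the entries 1 above the diagonal, so its value
    -- stays 1. This makes `Z` unitriangular, whereas `Y` collects the λ's below the diagonal.
    last-columns-diagonal : ∀ K N h → N ℕ.+ h ≡ K → columnOrbit (suc K) (δ K) N h ≈ 1#
    last-columns-diagonal K zero    h ≡.refl = δ-refl h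
    last-columns-diagonal K (suc N) h eq = begin
      columnOrbit (suc K) (δ K) (suc N) h
        ≈⟨ column-step (suc K) (columnOrbit (suc K) (δ K) N) (ℕ.m<n⇒m<1+n h<K)
             (λ K<h → contradiction (ℕ.≤-pred K<h) (ℕ.<⇒≱ h<K)) ⟩
      (previous (λ l → lam (suc l) * columnOrbit (suc K) (δ K) N l) h
        + b h * columnOrbit (suc K) (δ K) N h) + columnOrbit (suc K) (δ K) N (suc h)
        ≈⟨ +-cong (0+0≈0 (before h eq)
             (*-zero (last-columns-vanish K N h (≡.subst (N ℕ.+ h <_) eq ℕ.≤-refl))))
             (last-columns-diagonal K N (suc h) (≡.trans (ℕ.+-suc N h) eq)) ⟩
      0# + 1# ≈⟨ +-identityˡ _ ⟩
      1# ∎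
      where
      h<K : h < K
      h<K = ≡.subst (h <_) eq (s≤s (ℕ.m≤n+m h N))
      before : ∀ h → suc N ℕ.+ h ≡ K →
               previous (λ l → lam (suc l) * columnOrbit (suc K) (δ K) N l) h ≈ 0#
      before zero    eq = refl
      before (suc h) eq = *-zero (last-columns-vanish K N h
        (≡.subst (N ℕ.+ h <_) eq (ℕ.<-trans (ℕ.+-monoʳ-< N (ℕ.n<1+n h)) ℕ.≤-refl)))

    -- Once all powers of A are moved onto the column, the row left over is the unit row `δ k`,
    -- which reads off coordinate `k`.
    orbit-pairing : ∀ n {x y s k} → IsRowOrbit n x → IsColumnOrbit n y →
      k < n → (∀ j → j < n → x s j ≈ δ k j) →
      ∀ {N} i l → N ≡ i ℕ.+ s → pairing n (x N) (y l) ≈ y (i ℕ.+ l) k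
    orbit-pairing n {x} {y} {s} {k} row col k<n start i l ≡.refl = begin
      pairing n (x (i ℕ.+ s)) (y l)    ≈⟨ pairing-shift n {x} {y} row col i s l ⟩
      pairing n (x s) (y (i ℕ.+ l))    ≈⟨ sumFin-cong n (λ j → *-congʳ (start (toℕ j) (toℕ<n j))) ⟩
      pairing n (δ k) (y (i ℕ.+ l))    ≈⟨ pairing-δˡ n (y (i ℕ.+ l)) k<n ⟩
      y (i ℕ.+ l) k                    ∎

    -- Both sides come from the matrices X s whose rows are e₀ᵀA^(s+i) for i < k followed by
    -- w (s+m-1-j) for j < m, so that det (X e) = det (X 0) (det A)^e.  Pairing X e with the columns
    -- y l = A^l e₀ gives a block matrix with the Hankel matrix of y in the upper left corner;
    -- pairing X 0 with the columns A^(K-l) e_K gives one with that of w in the lower right corner.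
    module HankelDuality (k′ m′ e : ℕ)
      {y : ℕ → ℕ → Carrier} (y-orbit : IsColumnOrbit (suc (k′ ℕ.+ suc m′)) y)
      (y-start : ∀ h → y 0 h ≈ δ 0 h) (y-cut : ∀ N → y N (suc (k′ ℕ.+ suc m′)) ≈ 0#)
      {w : ℕ → ℕ → Carrier} (w-orbit : IsRowOrbit (suc (k′ ℕ.+ suc m′)) w)
      (w-start : ∀ j → j < suc (k′ ℕ.+ suc m′) → w e j ≈ δ (k′ ℕ.+ suc m′) j) where

      k m K n : ℕ
      k = suc k′
      m = suc m′
      K = k′ ℕ.+ m
      n = suc K

      a c′ : ℕ → ℕ → Carrier
      a  = rowOrbit n (δ 0)
      c′ = columnOrbit n (δ K)

      -- The rows `w` are listed with decreasing time, so that in X e they are e_Kᵀ A^(m-1), ...,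
      -- e_Kᵀ. Paired with the last `m` columns of `Y`, they then form an upper triangular block.
      X : ℕ → Matrix
      X s = append k (λ i → a (s ℕ.+ i)) (λ j → w (s ℕ.+ (m′ ∸ j)))

      Y Z : Matrix
      Y r l = y l r
      Z r l = c′ (K ∸ l) r

      det-X-suc : ∀ s → detℕ n (X (suc s)) ≈ detℕ n (X s) * detℕ n entry
      det-X-suc s = trans
        (detℕ-cong n {X (suc s)} {X s ⊠[ n ] entry} (λ i j _ j<n →
          append-lift (λ x x′ → ∀ j → j < n → x′ j ≈ Σ< n (λ l → x l * entry l j)) k
            {λ i → a (s ℕ.+ i)} {λ i → a (suc s ℕ.+ i)}
            {λ j → w (s ℕ.+ (m′ ∸ j))} {λ j → w (suc s ℕ.+ (m′ ∸ j))}
            (λ _ _ _ → refl) (λ i → w-orbit (s ℕ.+ (m′ ∸ i))) i j j<n))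
        (detℕ-⊠ n (X s) entry)

      det-X : ∀ s → detℕ n (X s) ≈ detℕ n (X 0) * pow (detℕ n entry) s
      det-X zero    = sym (*-identityʳ _)
      det-X (suc s) = begin
        detℕ n (X (suc s))                                              ≈⟨ det-X-suc s ⟩
        detℕ n (X s) * detℕ n entry                                     ≈⟨ *-congʳ (det-X s) ⟩
        (detℕ n (X 0) * pow (detℕ n entry) s) * detℕ n entry            ≈⟨ *-assoc _ _ _ ⟩
        detℕ n (X 0) * (pow (detℕ n entry) s * detℕ n entry)            ≈⟨ *-congˡ (*-comm _ _) ⟩
        detℕ n (X 0) * pow (detℕ n entry) (suc s)                       ∎

      X-top : ∀ s {i} → i < k → X s i ≡ a (s ℕ.+ i)
      X-top s i<k = append-< k {λ i → a (s ℕ.+ i)} i<k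

      X-bottom : ∀ s i → X s (k ℕ.+ i) ≡ w (s ℕ.+ (m′ ∸ i))
      X-bottom s i = append-+ k {λ i → a (s ℕ.+ i)} i

      pairing-≡ : ∀ {x x′ : ℕ → Carrier} (y : ℕ → Carrier) → x ≡ x′ → pairing n x y ≈ pairing n x′ y
      pairing-≡ y p = reflexive (≡.cong (λ x → pairing n x y) p)

      top-y : ∀ {i} l → i < k → pairing n (X e i) (y l) ≈ y (e ℕ.+ i ℕ.+ l) 0
      top-y {i} l i<k = trans (pairing-≡ (y l) (X-top e i<k))
        (orbit-pairing n {a} {y} (λ _ _ _ → refl) y-orbit (s≤s z≤n) (λ _ _ → refl) (e ℕ.+ i) l
          (≡.sym (ℕ.+-identityʳ _)))

      bottom-y : ∀ i l → pairing n (X e (k ℕ.+ i)) (y l) ≈ y (m′ ∸ i ℕ.+ l) K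
      bottom-y i l = trans (pairing-≡ (y l) (X-bottom e i))
        (orbit-pairing n {w} {y} w-orbit y-orbit ℕ.≤-refl w-start (m′ ∸ i) l (ℕ.+-comm e _))

      top-c : ∀ {i} l → i < k → pairing n (X 0 i) (c′ l) ≈ c′ (i ℕ.+ l) 0
      top-c {i} l i<k = trans (pairing-≡ (c′ l) (X-top 0 i<k))
        (orbit-pairing n {a} {c′} (λ _ _ _ → refl) (λ _ _ _ → refl) (s≤s z≤n) (λ _ _ → refl) i l
          (≡.sym (ℕ.+-identityʳ _)))

      -- Here the powers of A move onto the row, opposite to `top-c`: `w` is pinned down only at
      -- time `e`, while the column orbit starts at e_K and so extracts the last coordinate of `w`.
      bottom-c : ∀ i l → pairing n (X 0 (k ℕ.+ i)) (c′ l) ≈ w (l ℕ.+ (m′ ∸ i)) K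
      bottom-c i l = begin
        pairing n (X 0 (k ℕ.+ i)) (c′ l)
          ≈⟨ pairing-≡ (c′ l) (X-bottom 0 i) ⟩
        pairing n (w (m′ ∸ i)) (c′ l)
          ≈⟨ reflexive (≡.cong (λ l → pairing n (w (m′ ∸ i)) (c′ l)) (ℕ.+-identityʳ l)) ⟨
        pairing n (w (m′ ∸ i)) (c′ (l ℕ.+ 0))
          ≈⟨ pairing-shift n {w} {c′} w-orbit (λ _ _ _ → refl) l (m′ ∸ i) 0 ⟨
        pairing n (w (l ℕ.+ (m′ ∸ i))) (δ K)
          ≈⟨ Σ<-δ n (w (l ℕ.+ (m′ ∸ i))) ℕ.≤-refl ⟩
        w (l ℕ.+ (m′ ∸ i)) K ∎

      K≡m′+k : K ≡ m′ ℕ.+ k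
      K≡m′+k = ≡.trans (ℕ.+-suc k′ m′) (ℕ.+-comm k m′)

      m′∸-diagonal : ∀ {i} → i ≤ m′ → m′ ∸ i ℕ.+ (k ℕ.+ i) ≡ K
      m′∸-diagonal {i} i≤m′ = ≡.trans (≡.cong (m′ ∸ i ℕ.+_) (ℕ.+-comm k i))
          (≡.trans (≡.sym (ℕ.+-assoc (m′ ∸ i) i k))
            (≡.trans (≡.cong (ℕ._+ k) (ℕ.m∸n+n≡m i≤m′)) (≡.sym K≡m′+k)))

      m′∸-below : ∀ {i j} → j < i → i ≤ m′ → m′ ∸ i ℕ.+ (k ℕ.+ j) < K
      m′∸-below {i} {j} j<i i≤m′ = ℕ.≤-trans
        (ℕ.+-monoʳ-< (m′ ∸ i) (ℕ.+-monoʳ-< k j<i)) (ℕ.≤-reflexive (m′∸-diagonal i≤m′))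

      K∸[k+j] : ∀ j → K ∸ (k ℕ.+ j) ≡ m′ ∸ j
      K∸[k+j] j = ≡.trans (≡.cong (_∸ (k ℕ.+ j)) (ℕ.+-suc k′ m′)) (ℕ.[m+n]∸[m+o]≡n∸o k m′ j)

      det-Y : detℕ n Y ≈ prodRange n Λ
      det-Y = trans
        (detℕ-upper-triangular n Y (λ i j j<i i<n →
          columns-vanish n {y} y-orbit y-start y-cut j j<i (ℕ.<⇒≤ i<n)))
        (prodRange-cong n (columns-diagonal n {y} y-orbit y-start y-cut))

      det-Z : detℕ n Z ≈ 1#
      det-Z = trans
        (detℕ-lower-triangular n Z (λ i j i<j j<n → last-columns-vanish K (K ∸ j) i
          (ℕ.≤-trans (ℕ.+-monoʳ-< (K ∸ j) i<j) (ℕ.≤-reflexive (ℕ.m∸n+n≡m (ℕ.≤-pred j<n))))))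
        (prodRange-1 n (λ i i<n → last-columns-diagonal K (K ∸ i) i (ℕ.m∸n+n≡m (ℕ.≤-pred i<n))))

      -- The lower left block vanishes because its powers of A are at most m'+k-1 = K-1, too small
      -- to take e₀ to index K. On the diagonal of the lower right block the power is exactly K,
      -- which gives `Λ K`.
      det-XY : detℕ n (X e ⊠[ n ] Y) ≈
               detℕ k (λ i j → y (e ℕ.+ i ℕ.+ j) 0) * pow (Λ K) m
      det-XY = trans
        (detℕ-upper-block k m (X e ⊠[ n ] Y) (λ i j i<m j<k → trans (bottom-y i j)
          (columns-vanish n {y} y-orbit y-start y-cut _
            (ℕ.≤-trans (ℕ.+-mono-≤-< (ℕ.m∸n≤m m′ i) j<k) (ℕ.≤-reflexive (≡.sym K≡m′+k)))
            (ℕ.n≤1+n K))))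
        (*-cong
          (detℕ-cong k {λ i j → (X e ⊠[ n ] Y) i j} {λ i j → y (e ℕ.+ i ℕ.+ j) 0}
            (λ i j i<k _ → top-y j i<k))
          (trans
            (detℕ-upper-triangular m (λ i j → (X e ⊠[ n ] Y) (k ℕ.+ i) (k ℕ.+ j))
              (λ i j j<i i<m → trans (bottom-y i (k ℕ.+ j))
                (columns-vanish n {y} y-orbit y-start y-cut _ (m′∸-below j<i (ℕ.≤-pred i<m)) (ℕ.n≤1+n K))))
            (prodRange-const m (Λ K) (λ i i<m → trans (bottom-y i (k ℕ.+ i)) (trans
              (reflexive (≡.cong (λ N → y N K) (m′∸-diagonal (ℕ.≤-pred i<m))))
              (columns-diagonal n {y} y-orbit y-start y-cut K ℕ.≤-refl))))))

      -- In the upper rows the entry is coordinate 0 of A^(i+K-l) e_K, which is 0 for i < l and 1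
      -- for i = l. Thus the upper left block is unitriangular and the upper right one is zero.
      det-XZ : detℕ n (X 0 ⊠[ n ] Z) ≈ detℕ m (λ i j → w (m′ ∸ j ℕ.+ (m′ ∸ i)) K)
      det-XZ = trans
        (detℕ-lower-block k m (X 0 ⊠[ n ] Z) (λ i j i<k j<m → trans (top-c (K ∸ (k ℕ.+ j)) i<k)
          (last-columns-vanish K _ 0 (top-right i j i<k))))
        (trans (*-cong
          (trans
            (detℕ-lower-triangular k (X 0 ⊠[ n ] Z) (λ i j i<j j<k →
              trans (top-c (K ∸ j) (ℕ.<-trans i<j j<k))
                (last-columns-vanish K _ 0 (top-left i j i<j j<k))))
            (prodRange-1 k (λ i i<k → trans (top-c (K ∸ i) i<k)
              (last-columns-diagonal K _ 0 (≡.trans (ℕ.+-identityʳ _)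
                (ℕ.m+[n∸m]≡n (≤K i<k)))))))
          (detℕ-cong m {λ i j → (X 0 ⊠[ n ] Z) (k ℕ.+ i) (k ℕ.+ j)} {λ i j → w (m′ ∸ j ℕ.+ (m′ ∸ i)) K}
            (λ i j _ _ → trans (bottom-c i (K ∸ (k ℕ.+ j)))
              (reflexive (≡.cong (λ l → w (l ℕ.+ (m′ ∸ i)) K) (K∸[k+j] j))))))
          (*-identityˡ _))
        where
        ≤K : ∀ {i} → i < k → i ≤ K
        ≤K i<k = ℕ.≤-trans (ℕ.≤-pred i<k) (ℕ.m≤m+n k′ m)
        top-right : ∀ i j → i < k → i ℕ.+ (K ∸ (k ℕ.+ j)) ℕ.+ 0 < K
        top-right i j i<k = ≡.subst (_< K)
          (≡.sym (≡.trans (ℕ.+-identityʳ _) (≡.cong (i ℕ.+_) (K∸[k+j] j))))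
          (ℕ.+-mono-≤-< (ℕ.≤-pred i<k) (s≤s (ℕ.m∸n≤m m′ j)))
        top-left : ∀ i j → i < j → j < k → i ℕ.+ (K ∸ j) ℕ.+ 0 < K
        top-left i j i<j j<k = ≡.subst (_< K) (≡.sym (ℕ.+-identityʳ _))
          (ℕ.≤-trans (ℕ.+-monoˡ-< (K ∸ j) i<j) (ℕ.≤-reflexive (ℕ.m+[n∸m]≡n (≤K j<k))))

      duality : detℕ k (λ i j → y (e ℕ.+ i ℕ.+ j) 0) * pow (Λ K) m ≈
                (detℕ m (λ i j → w (m′ ∸ j ℕ.+ (m′ ∸ i)) K) * pow (detℕ n entry) e) * prodRange n Λ
      duality = begin
        detℕ k (λ i j → y (e ℕ.+ i ℕ.+ j) 0) * pow (Λ K) m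
          ≈⟨ det-XY ⟨
        detℕ n (X e ⊠[ n ] Y)
          ≈⟨ detℕ-⊠ n (X e) Y ⟩
        detℕ n (X e) * detℕ n Y
          ≈⟨ *-cong (det-X e) det-Y ⟩
        (detℕ n (X 0) * pow (detℕ n entry) e) * prodRange n Λ
          ≈⟨ *-congʳ (*-congʳ (trans (*-congˡ det-Z) (*-identityʳ _))) ⟨
        ((detℕ n (X 0) * detℕ n Z) * pow (detℕ n entry) e) * prodRange n Λ
          ≈⟨ *-congʳ (*-congʳ (trans (sym (detℕ-⊠ n (X 0) Z)) det-XZ)) ⟩
        (detℕ m (λ i j → w (m′ ∸ j ℕ.+ (m′ ∸ i)) K) * pow (detℕ n entry) e) * prodRange n Λ ∎

    -- Motzkin paths as the column orbit of e₀.

    module Paths (K : ℕ) where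
      open import Data.List using (List; []; _∷_; _++_; map)
      open FieldDefs F using (Path; flat; up; down; weight; allPaths; sumList)

      total : ∀ {h N} → List (Path K h N) → Carrier
      total ps = sumList (map (weight b lam) ps)

      total-++ : ∀ {h N} (ps qs : List (Path K h N)) → total (ps ++ qs) ≈ total ps + total qs
      total-++ []       qs = sym (+-identityˡ _)
      total-++ (p ∷ ps) qs = trans (+-congˡ (total-++ ps qs)) (sym (+-assoc _ _ _))

      total-map : ∀ {h h′ N N′} {f : Path K h N → Path K h′ N′} x →
        (∀ p → weight b lam (f p) ≈ x * weight b lam p) → ∀ ps → total (map f ps) ≈ x * total ps
      total-map x e []       = sym (zeroʳ x)
      total-map x e (p ∷ ps) = trans (+-cong (e p) (total-map x e ps)) (sym (distribˡ x _ _))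

      pathSum : ℕ → ℕ → Carrier
      pathSum N h = total (allPaths K h N)

      -- The cut above K is essential: `Path K h N` bounds only the up steps, so a path starting at
      -- h > K can still descend to 0 and `pathSum` need not vanish there.
      pathColumn : ℕ → ℕ → Carrier
      pathColumn N = append (suc K) (pathSum N) (λ _ → 0#)

      pathColumn-≤ : ∀ N {h} → h ≤ K → pathColumn N h ≡ pathSum N h
      pathColumn-≤ N h≤K = append-< (suc K) (s≤s h≤K)

      pathColumn-cut : ∀ N → pathColumn N (suc K) ≈ 0#
      pathColumn-cut N = reflexive (≡.trans
        (≡.cong (pathColumn N) (≡.sym (ℕ.+-identityʳ (suc K)))) (append-+ (suc K) {pathSum N} 0))

      pathColumn-start : ∀ h → pathColumn 0 h ≈ δ 0 h
      pathColumn-start zero    = +-identityʳ 1#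
      pathColumn-start (suc h) = append-lift (λ x _ → x ≈ 0#) K
        {pathSum 0 ∘ suc} {pathSum 0 ∘ suc} {λ _ → 0#} {λ _ → 0#} (λ _ → refl) (λ _ → refl) h

      assemble : ∀ N h (us ds : List (Path K h (suc N))) →
        total us ≈ pathColumn N (suc h) → total ds ≈ previous (λ l → lam (suc l) * pathSum N l) h →
        total (map flat (allPaths K h N) ++ (us ++ ds)) ≈
          (previous (λ l → lam (suc l) * pathSum N l) h + b h * pathSum N h) + pathColumn N (suc h)
      assemble N h us ds u d = begin
        total (map flat ps ++ (us ++ ds))
          ≈⟨ trans (total-++ (map flat ps) _)
               (+-cong (total-map (b h) (λ _ → refl) ps) (trans (total-++ us ds) (+-cong u d))) ⟩
        b h * total ps + (pathColumn N (suc h) + previous (λ l → lam (suc l) * pathSum N l) h)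
          ≈⟨ solve 3 (λ x y z → x :+ (y :+ z) := (z :+ x) :+ y) refl _ _ _ ⟩
        (previous (λ l → lam (suc l) * pathSum N l) h + b h * total ps) + pathColumn N (suc h) ∎
        where
        ps : List (Path K h N)
        ps = allPaths K h N

      total-up : ∀ N {h} (h<K : suc h ≤ K) →
                 total (map (up h<K) (allPaths K (suc h) N)) ≈ pathColumn N (suc h)
      total-up N {h} h<K = begin
        total (map (up h<K) ps)  ≈⟨ total-map 1# (λ p → sym (*-identityˡ _)) ps ⟩
        1# * total ps            ≈⟨ *-identityˡ _ ⟩
        total ps                 ≈⟨ reflexive (pathColumn-≤ N h<K) ⟨
        pathColumn N (suc h)     ∎
        where
        ps : List (Path K (suc h) N)
        ps = allPaths K (suc h) N

      no-up : ∀ N {h} → h ≤ K → ¬ suc h ≤ K → 0# ≈ pathColumn N (suc h)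
      no-up N h≤K h≮K = sym (trans
        (reflexive (≡.cong (pathColumn N ∘ suc) (ℕ.≤-antisym h≤K (ℕ.≮⇒≥ h≮K)))) (pathColumn-cut N))

      total-down : ∀ N h → total (map down (allPaths K h N)) ≈ lam (suc h) * pathSum N h
      total-down N h = total-map (lam (suc h)) (λ _ → refl) (allPaths K h N)

      -- Decomposition by the first step. The case split repeats the decision made in `allPaths`;
      -- when the up step is forbidden, h = K and the missing term is the 0 at height K+1.
      pathSum-suc : ∀ N h → h ≤ K → pathSum (suc N) h ≈
        (previous (λ l → lam (suc l) * pathSum N l) h + b h * pathSum N h) + pathColumn N (suc h)
      pathSum-suc N zero    h≤K with 1 ℕ.≤? K
      ... | yes h<K = assemble N 0 _ [] (total-up N h<K) refl
      ... | no  h≮K = assemble N 0 [] [] (no-up N h≤K h≮K) refl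
      pathSum-suc N (suc h) h≤K with suc (suc h) ℕ.≤? K
      ... | yes h<K = assemble N (suc h) _ (map down (allPaths K h N)) (total-up N h<K) (total-down N h)
      ... | no  h≮K = assemble N (suc h) [] (map down (allPaths K h N)) (no-up N h≤K h≮K) (total-down N h)

      pathColumn-orbit : IsColumnOrbit (suc K) pathColumn
      pathColumn-orbit N h h<n@(s≤s h≤K) = begin
        pathColumn (suc N) h
          ≈⟨ reflexive (pathColumn-≤ (suc N) h≤K) ⟩
        pathSum (suc N) h
          ≈⟨ pathSum-suc N h h≤K ⟩
        (previous (λ l → lam (suc l) * pathSum N l) h + b h * pathSum N h) + pathColumn N (suc h)
          ≈⟨ +-congʳ (+-cong (previous-column h h≤K) (*-congˡ (reflexive (pathColumn-≤ N h≤K)))) ⟨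
        (previous (λ l → lam (suc l) * pathColumn N l) h + b h * pathColumn N h) + pathColumn N (suc h)
          ≈⟨ column-step (suc K) (pathColumn N) h<n (λ n≤h →
               trans (reflexive (≡.cong (pathColumn N) (ℕ.≤-antisym h<n n≤h))) (pathColumn-cut N)) ⟨
        Σ< (suc K) (λ l → entry h l * pathColumn N l) ∎
        where
        previous-column : ∀ h → h ≤ K → previous (λ l → lam (suc l) * pathColumn N l) h ≈
                                        previous (λ l → lam (suc l) * pathSum N l) h
        previous-column zero    _   = refl
        previous-column (suc h) h<K = *-congˡ (reflexive (pathColumn-≤ N (ℕ.<⇒≤ h<K)))

    -- Extending the column orbit to negative times.

    module Extension (K : ℕ) {g : ℤ → Carrier} (ext : FieldDefs.IsMuExtension F K b lam g) where
      open Paths K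

      order : ℕ
      order = proj₁ (proj₂ ext)

      coeff : ℕ → Carrier
      coeff = proj₁ (proj₂ (proj₂ ext))

      coeff-last≉0 : ¬ coeff (suc order) ≈ 0#
      coeff-last≉0 = proj₁ (proj₂ (proj₂ (proj₂ ext)))

      -- Always with the order and coefficients that come with `g`; for these the solutions form a
      -- space closed under shifts.
      Recurrent : (ℤ → Carrier) → Set ℓ
      Recurrent f = ∀ N → f N ≈ sumRange (suc order) (λ i → coeff (suc i) * f (N ℤ.- + suc i))

      recurrent-shift : ∀ {f} → Recurrent f → Recurrent (f ∘ ℤ.suc)
      recurrent-shift {f} rec N = trans (rec (ℤ.suc N)) (sumRange-cong (suc order) (λ i _ →
        *-congˡ (reflexive (≡.cong f (ℤ.+-assoc (+ 1) N (ℤ.- + suc i))))))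

      recurrent-combine : ∀ {f h} x → Recurrent f → Recurrent h → Recurrent (λ N → f N + x * h N)
      recurrent-combine {f} {h} x rf rh N = begin
        f N + x * h N
          ≈⟨ +-cong (rf N) (trans (*-congˡ (rh N)) (sym (sumRange-*ˡ (suc order) x _))) ⟩
        sumRange (suc order) (λ i → coeff (suc i) * f (N ℤ.- + suc i)) +
        sumRange (suc order) (λ i → x * (coeff (suc i) * h (N ℤ.- + suc i)))
          ≈⟨ sumRange-+ (suc order) _ _ ⟨
        sumRange (suc order) (λ i →
          coeff (suc i) * f (N ℤ.- + suc i) + x * (coeff (suc i) * h (N ℤ.- + suc i)))
          ≈⟨ sumRange-cong (suc order) (λ i _ →
               solve 4 (λ c f x h → c :* f :+ x :* (c :* h) := c :* (f :+ x :* h)) refl _ _ _ _) ⟩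
        sumRange (suc order) (λ i →
          coeff (suc i) * (f (N ℤ.- + suc i) + x * h (N ℤ.- + suc i))) ∎

      -- The recurrence is run backwards: its last coefficient is nonzero, so the oldest term is
      -- determined by the newer ones.
      recurrent-vanish : ∀ {f} → Recurrent f → (∀ N → f (+ N) ≈ 0#) → ∀ N → f N ≈ 0#
      recurrent-vanish {f} rec z (+ N)      = z N
      recurrent-vanish {f} rec z ℤ.-[1+ N ] = backward (suc N) 0
        where
        backward : ∀ r q → f (q ℤ.⊖ r) ≈ 0#
        backward zero    q       = z q
        backward (suc r) (suc q) = trans (reflexive (≡.cong f (ℤ.[1+m]⊖[1+n]≡m⊖n q r))) (backward r q)
        backward (suc r) zero    = cancel-nonzero coeff-last≉0 (begin
          coeff (suc order) * f ℤ.-[1+ r ]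
            ≈⟨ *-congˡ (reflexive (≡.cong f latest)) ⟩
          coeff (suc order) * f (M ℤ.- + suc order)
            ≈⟨ trans (+-congʳ (sumRange-zero order earlier)) (+-identityˡ _) ⟨
          sumRange (suc order) (λ i → coeff (suc i) * f (M ℤ.- + suc i))
            ≈⟨ rec M ⟨
          f M
            ≈⟨ backward r order ⟩
          0# ∎)
          where
          -- The index whose recurrence has -(r+1) as its oldest term. `M` and all other indices
          -- involved are of the form q - r with q ≥ 0, where `f` is already known to vanish.
          M : ℤ
          M = order ℤ.⊖ r
          earlier : ∀ i → i < order → coeff (suc i) * f (M ℤ.- + suc i) ≈ 0#
          earlier i i<o = *-zero (trans
            (reflexive (≡.cong (λ n → f (n ℤ.⊖ r ℤ.- + suc i)) (≡.sym (ℕ.m+[n∸m]≡n i<o))))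
            (trans (reflexive (≡.cong f (⊖-cancel (suc i) (order ∸ suc i) r)))
                   (backward r (order ∸ suc i))))
          latest : ℤ.-[1+ r ] ≡ M ℤ.- + suc order
          latest = ≡.trans (≡.sym (⊖-cancel (suc order) 0 (suc r))) (≡.cong (ℤ._- + suc order)
            (≡.trans (ℤ.[1+m]⊖[1+n]≡m⊖n (order ℕ.+ 0) r)
                     (≡.cong (ℤ._⊖ r) (ℕ.+-identityʳ order))))

      -- V j N stands for (A^N e₀)_j, read off g from the rows of A v_N = v_(N+1).  Being a combination
      -- of shifts of g it satisfies the recurrence of g, which forces V (K+1) to vanish at negative N too.
      V : ℕ → ℤ → Carrier
      V zero          = g
      V (suc zero)    N = V zero (ℤ.suc N) + - b zero * V zero N
      V (suc (suc j)) N = (V (suc j) (ℤ.suc N) + - b (suc j) * V (suc j) N) + - lam (suc j) * V j N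

      V-suc : ∀ j N → V j (ℤ.suc N) ≈
        (previous (λ l → lam (suc l) * V l N) j + b j * V j N) + V (suc j) N
      V-suc zero N = sym (trans (+-congʳ (+-identityˡ _)) (add-back _ _ _))
      V-suc (suc j) N = sym (begin
        (p + q) + ((x + - b (suc j) * V (suc j) N) + - lam (suc j) * V j N)
          ≈⟨ solve 5 (λ p q x q′ p′ → (p :+ q) :+ ((x :+ q′) :+ p′) := p :+ ((q :+ (x :+ q′)) :+ p′))
               refl p q x (- b (suc j) * V (suc j) N) (- lam (suc j) * V j N) ⟩
        p + ((q + (x + - b (suc j) * V (suc j) N)) + - lam (suc j) * V j N)
          ≈⟨ +-congˡ (+-congʳ (add-back _ _ _)) ⟩
        p + (x + - lam (suc j) * V j N)
          ≈⟨ add-back _ _ _ ⟩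
        x ∎)
        where
        p q x : Carrier
        p = lam (suc j) * V j N
        q = b (suc j) * V (suc j) N
        x = V (suc j) (ℤ.suc N)

      V-recurrent : Recurrent g → ∀ j → Recurrent (V j)
      V-recurrent rec zero          = rec
      V-recurrent rec (suc zero)    =
        recurrent-combine {V 0 ∘ ℤ.suc} {V 0} _ (recurrent-shift {V 0} rec) rec
      V-recurrent rec (suc (suc j)) =
        let ih = V-recurrent rec (suc j) in
        recurrent-combine {λ N → V (suc j) (ℤ.suc N) + - b (suc j) * V (suc j) N} {V j} _
          (recurrent-combine {V (suc j) ∘ ℤ.suc} {V (suc j)} _ (recurrent-shift {V (suc j)} ih) ih)
          (V-recurrent rec j)

      -- Both sides satisfy the same three-term relation, which determines coordinate j+1 at time N
      -- from coordinates up to j at times N and N+1. Hence the induction is on `j`, for all N at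
      -- once.
      V-paths : ∀ j → j ≤ suc K → ∀ N → V j (+ N) ≈ pathColumn N j
      V-paths zero    _     N = proj₁ ext N
      V-paths (suc j) j<n   N = +-cancelˡ _ _ _ (begin
        (previous (λ l → lam (suc l) * V l (+ N)) j + b j * V j (+ N)) + V (suc j) (+ N)
          ≈⟨ V-suc j (+ N) ⟨
        V j (+ suc N)
          ≈⟨ V-paths j (ℕ.<⇒≤ j<n) (suc N) ⟩
        pathColumn (suc N) j
          ≈⟨ trans (pathColumn-orbit N j j<n) (column-step (suc K) (pathColumn N) j<n (λ n≤j →
               trans (reflexive (≡.cong (pathColumn N) (ℕ.≤-antisym j<n n≤j))) (pathColumn-cut N))) ⟩
        (previous (λ l → lam (suc l) * pathColumn N l) j + b j * pathColumn N j) + pathColumn N (suc j)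
          ≈⟨ +-congʳ (+-cong (before j j<n) (*-congˡ (V-paths j (ℕ.<⇒≤ j<n) N))) ⟨
        (previous (λ l → lam (suc l) * V l (+ N)) j + b j * V j (+ N)) + pathColumn N (suc j) ∎)
        where
        before : ∀ j → j < suc K → previous (λ l → lam (suc l) * V l (+ N)) j ≈
                                   previous (λ l → lam (suc l) * pathColumn N l) j
        before zero    _   = refl
        before (suc j) j<n = *-congˡ (V-paths j (ℕ.<⇒≤ (ℕ.<⇒≤ j<n)) N)

      V-cut : ∀ N → V (suc K) N ≈ 0#
      V-cut = recurrent-vanish {V (suc K)}
        (V-recurrent (proj₂ (proj₂ (proj₂ (proj₂ ext)))) (suc K))
        (λ N → trans (V-paths (suc K) ℕ.≤-refl N) (pathColumn-cut N))

  -- Reversal of the parameters.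

  module _ (b lam : ℕ → Carrier) (K : ℕ) {g : ℤ → Carrier}
           (ext : FieldDefs.IsMuExtension F K (FieldDefs.revB F K b) (FieldDefs.revLam F K lam) g)
           (e : ℕ) where
    private
      module E = Tridiagonal.Extension (FieldDefs.revB F K b) (FieldDefs.revLam F K lam) K ext
    open Tridiagonal b lam

    -- Reversing the basis turns the matrix of the parameters revB, revLam into the transpose of A,
    -- and hence the columns E.V N into rows; the argument of previous is 1 + (K - i) for i ≤ K, so
    -- that entry K+1 of a row is zero.
    reversedRow : ℕ → ℕ → Carrier
    reversedRow N i = previous (λ j → E.V j (+ N ℤ.- + e)) (suc K ∸ i)

    reversedRow-≡ : ∀ N i q → i ℕ.+ q ≡ suc K →
                    reversedRow N i ≡ previous (λ j → E.V j (+ N ℤ.- + e)) q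
    reversedRow-≡ N i q eq = ≡.cong (previous (λ j → E.V j (+ N ℤ.- + e)))
      (≡.trans (≡.cong (_∸ i) (≡.sym eq)) (ℕ.m+n∸m≡n i q))

    -- Under i ↦ K-i the 1's and the λ's exchange sides of the diagonal, so the column relation
    -- `E.V-suc` becomes the row relation for the original parameters.
    reversedRow-orbit : IsRowOrbit (suc K) reversedRow
    reversedRow-orbit N i (s≤s i≤K) = begin
      reversedRow (suc N) i
        ≈⟨ reflexive (≡.trans (at (suc N)) (≡.cong (E.V j) (ℤ.+-assoc (+ 1) (+ N) (ℤ.- + e)))) ⟩
      E.V j (ℤ.suc M)
        ≈⟨ E.V-suc j M ⟩
      (previous (λ l → lam (K ∸ l) * E.V l M) j + b (K ∸ j) * E.V j M) + E.V (suc j) M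
        ≈⟨ +-cong (+-cong (after j i+j) (trans (*-comm _ _)
             (*-cong (reflexive (≡.sym (at N))) (reflexive (≡.cong b (ℕ.m∸[m∸n]≡n i≤K))))))
             (sym (before i j i+j)) ⟩
      (reversedRow N (suc i) * lam (suc i) + reversedRow N i * b i) + previous (reversedRow N) i
        ≈⟨ solve 3 (λ x y z → (x :+ y) :+ z := (z :+ y) :+ x) refl _ _ _ ⟩
      (previous (reversedRow N) i + reversedRow N i * b i) + reversedRow N (suc i) * lam (suc i)
        ≈⟨ row-step (suc K) (reversedRow N) (s≤s i≤K) (λ K<1+i →
             reflexive (reversedRow-≡ N (suc i) 0
               (≡.trans (ℕ.+-identityʳ _) (ℕ.≤-antisym (s≤s i≤K) K<1+i)))) ⟨
      Σ< (suc K) (λ l → reversedRow N l * entry l i) ∎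
      where
      M : ℤ
      M = + N ℤ.- + e
      j : ℕ
      j = K ∸ i
      i+j : i ℕ.+ j ≡ K
      i+j = ℕ.m+[n∸m]≡n i≤K
      at : ∀ N → reversedRow N i ≡ E.V j (+ N ℤ.- + e)
      at N = reversedRow-≡ N i (suc j) (≡.trans (ℕ.+-suc i j) (≡.cong suc i+j))
      after : ∀ j → i ℕ.+ j ≡ K → previous (λ l → lam (K ∸ l) * E.V l M) j ≈
                                  reversedRow N (suc i) * lam (suc i)
      after zero    eq = sym (zero-* (reflexive (reversedRow-≡ N (suc i) 0 (≡.cong suc eq))))
      after (suc l) eq = trans (*-comm _ _) (*-cong
        (reflexive (≡.sym (reversedRow-≡ N (suc i) (suc l) (≡.cong suc eq))))
        (reflexive (≡.cong lam (≡.trans (≡.cong (_∸ l) (≡.trans (≡.sym eq) (ℕ.+-suc i l)))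
                                        (ℕ.m+n∸n≡m (suc i) l)))))
      before : ∀ i j → i ℕ.+ j ≡ K → previous (reversedRow N) i ≈ E.V (suc j) M
      -- Column 0 has no left neighbour; the leftover term is coordinate K+1, which is zero at
      -- negative times too.
      before zero    j ≡.refl = sym (E.V-cut M)
      before (suc i) j eq     = reflexive (reversedRow-≡ N i (suc (suc j))
        (≡.trans (ℕ.+-suc i (suc j)) (≡.cong suc (≡.trans (ℕ.+-suc i j) eq))))

    reversedRow-start : ∀ i → i < suc K → reversedRow e i ≈ δ K i
    reversedRow-start i (s≤s i≤K) = begin
      reversedRow e i
        ≈⟨ reflexive (reversedRow-≡ e i (suc (K ∸ i))
             (≡.trans (ℕ.+-suc i (K ∸ i)) (≡.cong suc (ℕ.m+[n∸m]≡n i≤K)))) ⟩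
      E.V (K ∸ i) (+ e ℤ.- + e)
        ≈⟨ reflexive (≡.cong (E.V (K ∸ i)) (ℤ.+-inverseʳ (+ e))) ⟩
      E.V (K ∸ i) (+ 0)
        ≈⟨ E.V-paths (K ∸ i) (ℕ.≤-trans (ℕ.m∸n≤m K i) (ℕ.n≤1+n K)) 0 ⟩
      Tridiagonal.Paths.pathColumn (FieldDefs.revB F K b) (FieldDefs.revLam F K lam) K 0 (K ∸ i)
        ≈⟨ Tridiagonal.Paths.pathColumn-start (FieldDefs.revB F K b) (FieldDefs.revLam F K lam) K (K ∸ i) ⟩
      δ 0 (K ∸ i)
        ≈⟨ reflexive (δ-reverse i≤K) ⟩
      δ K i ∎
      where
      δ-reverse : ∀ {i K} → i ≤ K → δ 0 (K ∸ i) ≡ δ K i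
      δ-reverse {K = zero}  z≤n       = ≡.refl
      δ-reverse {K = suc K} z≤n       = ≡.refl
      δ-reverse             (s≤s i≤K) = δ-reverse i≤K

    reversedRow-last : ∀ N → reversedRow N K ≡ g (+ N ℤ.- + e)
    reversedRow-last N = reversedRow-≡ N K 1 (ℕ.+-comm K 1)

  -- Products of powers of the λ's.

  prodRange-* : ∀ n (f g : ℕ → Carrier) →
                prodRange n (λ i → f i * g i) ≈ prodRange n f * prodRange n g
  prodRange-* zero    f g = sym (*-identityˡ 1#)
  prodRange-* (suc n) f g = trans (*-congʳ (prodRange-* n f g))
    (solve 4 (λ x y u v → (x :* y) :* (u :* v) := (x :* u) :* (y :* v)) refl _ _ _ _)

  pow-* : ∀ x y n → pow (x * y) n ≈ pow x n * pow y n
  pow-* x y zero    = sym (*-identityˡ 1#)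
  pow-* x y (suc n) = trans (*-congˡ (pow-* x y n))
    (solve 4 (λ x y u v → (x :* y) :* (u :* v) := (x :* u) :* (y :* v)) refl x y _ _)

  pow-+ : ∀ x m n → pow x (m ℕ.+ n) ≈ pow x m * pow x n
  pow-+ x zero    n = sym (*-identityˡ _)
  pow-+ x (suc m) n = trans (*-congˡ (pow-+ x m n)) (sym (*-assoc x _ _))

  pow-cong : ∀ {x y} n → x ≈ y → pow x n ≈ pow y n
  pow-cong zero    p = refl
  pow-cong (suc n) p = *-cong p (pow-cong n p)

  pow-1 : ∀ n → pow 1# n ≈ 1#
  pow-1 zero    = refl
  pow-1 (suc n) = trans (*-identityˡ _) (pow-1 n)

  pow-inverse : ∀ {x r} n → x * r ≈ 1# → pow x n * pow r n ≈ 1#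
  pow-inverse {x} {r} n xr = trans (sym (pow-* x r n)) (trans (pow-cong n xr) (pow-1 n))

  prodRange-pow : ∀ n (f : ℕ → Carrier) m → prodRange n (λ i → pow (f i) m) ≈ pow (prodRange n f) m
  prodRange-pow zero    f m = sym (pow-1 m)
  prodRange-pow (suc n) f m = trans (*-congʳ (prodRange-pow n f m)) (sym (pow-* (prodRange n f) (f n) m))

  -- Double counting: `f i` divides the prefix products of lengths i+1, ..., n, that is n-i of them.
  prodRange-prefixes : ∀ n (f : ℕ → Carrier) →
    prodRange (suc n) (λ l → prodRange l f) ≈ prodRange n (λ i → pow (f i) (n ∸ i))
  prodRange-prefixes zero    f = *-identityˡ 1#
  prodRange-prefixes (suc n) f = begin
    prodRange (suc n) (λ l → prodRange l f) * (prodRange n f * f n)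
      ≈⟨ *-congʳ (prodRange-prefixes n f) ⟩
    prodRange n (λ i → pow (f i) (n ∸ i)) * (prodRange n f * f n)
      ≈⟨ solve 3 (λ x y z → x :* (y :* z) := (y :* x) :* z) refl _ _ _ ⟩
    (prodRange n f * prodRange n (λ i → pow (f i) (n ∸ i))) * f n
      ≈⟨ *-congʳ (prodRange-* n f _) ⟨
    prodRange n (λ i → pow (f i) (suc (n ∸ i))) * f n
      ≈⟨ *-cong
           (prodRange-cong n (λ i i<n → reflexive (≡.cong (pow (f i)) (≡.sym (ℕ.+-∸-assoc 1 (ℕ.<⇒≤ i<n))))))
           (trans (sym (*-identityʳ (f n))) (reflexive (≡.cong (pow (f n))
             (≡.sym (ℕ.m+n∸n≡m 1 n))))) ⟩
    prodRange n (λ i → pow (f i) (suc n ∸ i)) * pow (f n) (suc n ∸ n) ∎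

  open FieldDefs F using (ipow; lamProd)

  ipow-⊖ : ∀ x (x≉0 : ¬ x ≈ 0#) a c → pow x c * ipow x x≉0 (a ℤ.⊖ c) ≈ pow x a
  ipow-⊖ x x≉0 a       zero    = *-identityˡ _
  ipow-⊖ x x≉0 zero    (suc c) = pow-inverse (suc c) (Field.inverse F x x≉0)
  ipow-⊖ x x≉0 (suc a) (suc c) = begin
    (x * pow x c) * ipow x x≉0 (suc a ℤ.⊖ suc c)
      ≈⟨ *-congˡ (reflexive (≡.cong (ipow x x≉0) (ℤ.[1+m]⊖[1+n]≡m⊖n a c))) ⟩
    (x * pow x c) * ipow x x≉0 (a ℤ.⊖ c)
      ≈⟨ *-assoc _ _ _ ⟩
    x * (pow x c * ipow x x≉0 (a ℤ.⊖ c))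
      ≈⟨ *-congˡ (ipow-⊖ x x≉0 a c) ⟩
    x * pow x a ∎

  pow-split : ∀ x (x≉0 : ¬ x ≈ 0#) a m c → c ≤ a ℕ.+ m →
              pow x (a ℕ.+ m ∸ c) ≈ pow x m * ipow x x≉0 (a ℤ.⊖ c)
  pow-split x x≉0 a m c c≤ = cancel-inverse (pow-inverse c (Field.inverse F x x≉0)) (begin
    pow x c * pow x (a ℕ.+ m ∸ c)                  ≈⟨ pow-+ x c _ ⟨
    pow x (c ℕ.+ (a ℕ.+ m ∸ c))                    ≈⟨ reflexive (≡.cong (pow x) (ℕ.m+[n∸m]≡n c≤)) ⟩
    pow x (a ℕ.+ m)                                ≈⟨ pow-+ x a m ⟩
    pow x a * pow x m                              ≈⟨ *-congʳ (ipow-⊖ x x≉0 a c) ⟨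
    (pow x c * ipow x x≉0 (a ℤ.⊖ c)) * pow x m     ≈⟨ solve 3 (λ x y z → (x :* y) :* z := x :* (z :* y)) refl _ _ _ ⟩
    pow x c * (pow x m * ipow x x≉0 (a ℤ.⊖ c))     ∎)

  -- The exponent K-i splits as m + (k'-i). The second summand is negative for i > k', whence the
  -- integer powers.
  prefixes-lamProd : ∀ lam lamNZ k′ m →
    prodRange (suc (k′ ℕ.+ m)) (λ l → prodRange l (λ i → lam (suc i))) ≈
      pow (prodRange (k′ ℕ.+ m) (λ i → lam (suc i))) m * lamProd lam lamNZ (k′ ℕ.+ m) (suc k′)
  prefixes-lamProd lam lamNZ k′ m = begin
    prodRange (suc K) (λ l → prodRange l (λ i → lam (suc i)))
      ≈⟨ prodRange-prefixes K (λ i → lam (suc i)) ⟩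
    prodRange K (λ i → pow (lam (suc i)) (K ∸ i))
      ≈⟨ prodRange-cong K (λ i i<K → trans (pow-split (lam (suc i)) (lamNZ i) k′ m i (ℕ.<⇒≤ i<K))
           (*-congˡ (reflexive (≡.cong (ipow (lam (suc i)) (lamNZ i))
             (≡.sym (ℤ.[1+m]⊖[1+n]≡m⊖n k′ i)))))) ⟩
    prodRange K (λ i → pow (lam (suc i)) m * ipow (lam (suc i)) (lamNZ i) (+ suc k′ ℤ.- + suc i))
      ≈⟨ prodRange-* K (λ i → pow (lam (suc i)) m) _ ⟩
    prodRange K (λ i → pow (lam (suc i)) m) * lamProd lam lamNZ K (suc k′)
      ≈⟨ *-congʳ (prodRange-pow K (λ i → lam (suc i)) m) ⟩
    pow (prodRange K (λ i → lam (suc i))) m * lamProd lam lamNZ K (suc k′) ∎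
    where
    K : ℕ
    K = k′ ℕ.+ m

  prodRange-inverse : ∀ n {f : ℕ → Carrier} (f≉0 : ∀ i → ¬ f i ≈ 0#) →
    prodRange n f * prodRange n (λ i → Field.inv F (f i) (f≉0 i)) ≈ 1#
  prodRange-inverse n {f} f≉0 = trans (sym (prodRange-* n f _))
    (prodRange-1 n (λ i _ → Field.inverse F (f i) (f≉0 i)))

-- Index arithmetic and the final identity.

+[m+m]∸2 : ∀ N m′ → N ℕ.+ (suc m′ ℕ.+ suc m′) ∸ 2 ≡ N ℕ.+ (m′ ℕ.+ m′)
+[m+m]∸2 N m′ = ≡.cong (_∸ 2) (≡.trans (≡.cong (λ x → N ℕ.+ suc x) (ℕ.+-suc m′ m′))
  (≡.trans (ℕ.+-suc N _) (≡.cong suc (ℕ.+-suc N _))))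

-- Index of the entry (i, j) of the second Hankel matrix: (m-1-j) + (m-1-i) - (n+2m-2) = -(n+i+j).
reversed-index : ∀ n {m′ i j} → i ≤ m′ → j ≤ m′ →
  + (m′ ∸ j ℕ.+ (m′ ∸ i)) ℤ.- + (n ℕ.+ (m′ ℕ.+ m′)) ≡ ℤ.- + (n ℕ.+ i ℕ.+ j)
reversed-index n {m′} {i} {j} i≤m′ j≤m′ = ≡.trans
  (≡.cong (λ x → + (q ℕ.+ p) ℤ.- + (n ℕ.+ x)) (≡.sym (≡.cong₂ ℕ._+_ (ℕ.m∸n+n≡m i≤m′) (ℕ.m∸n+n≡m j≤m′))))
  (regroup (+ n) (+ p) (+ q) (+ i) (+ j))
  where
  p q : ℕ
  p = m′ ∸ i
  q = m′ ∸ j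
  regroup : ∀ n p q i j → (q ℤ.+ p) ℤ.- (n ℤ.+ ((p ℤ.+ i) ℤ.+ (q ℤ.+ j))) ≡ ℤ.- ((n ℤ.+ i) ℤ.+ j)
  regroup = solve-∀

theorem6p1 : ∀ {c ℓ} (F : Field c ℓ) → let open FieldDefs F in
    (b lam : ℕ → Carrier) → (lamNZ : ∀ i → ¬ (lam (suc i) ≈ 0#)) →
    (k m n : ℕ) → 1 ≤ k → 1 ≤ m →
    ¬ (det (suc (k ℕ.+ m ∸ 1)) (A (k ℕ.+ m ∸ 1) b lam) ≈ 0#) →
    (g' : ℤ → Carrier) →
    IsMuExtension (k ℕ.+ m ∸ 1) (revB (k ℕ.+ m ∸ 1) b) (revLam (k ℕ.+ m ∸ 1) lam) g' →
    det k (λ i j → μ (k ℕ.+ m ∸ 1) b lam (n ℕ.+ toℕ i ℕ.+ toℕ j ℕ.+ (m ℕ.+ m) ∸ 2))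
    ≈ (lamProd lam lamNZ (k ℕ.+ m ∸ 1) k
    * pow (det (suc (k ℕ.+ m ∸ 1)) (A (k ℕ.+ m ∸ 1) b lam)) (n ℕ.+ (m ℕ.+ m) ∸ 2))
    * det m (λ i j → g' (ℤ.- (+ (n ℕ.+ toℕ i ℕ.+ toℕ j))))
theorem6p1 F b lam lamNZ (suc k′) (suc m′) n _ _ _ g' ext =
  -- The factor (λ₁⋯λ_K)^m is the lower right block of `det-XY`; its reciprocal is the m-th power of
  -- the product of the inverses.
  cancel-inverse (pow-inverse m (prodRange-inverse K lamNZ)) (begin
    pow (Λ K) m * det k (λ i j → μ K b lam (n ℕ.+ toℕ i ℕ.+ toℕ j ℕ.+ (m ℕ.+ m) ∸ 2))
      ≈⟨ trans (*-comm _ _) (*-congʳ (detℕ-cong k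
           {λ i j → μ K b lam (n ℕ.+ i ℕ.+ j ℕ.+ (m ℕ.+ m) ∸ 2)}
           {λ i j → pathColumn (e ℕ.+ i ℕ.+ j) 0}
           (λ i j _ _ → reflexive (≡.cong (μ K b lam) (moment-index i j))))) ⟩
    detℕ k (λ i j → pathColumn (e ℕ.+ i ℕ.+ j) 0) * pow (Λ K) m
      ≈⟨ duality ⟩
    (detℕ m (λ i j → w (m′ ∸ j ℕ.+ (m′ ∸ i)) K) * pow D e) * prodRange (suc K) Λ
      ≈⟨ *-cong
           (*-cong
             (detℕ-cong m {λ i j → w (m′ ∸ j ℕ.+ (m′ ∸ i)) K} {λ i j → g' (ℤ.- + (n ℕ.+ i ℕ.+ j))}
               (λ i j i<m j<m → reflexive (≡.trans
                 (reversedRow-last b lam K ext e (m′ ∸ j ℕ.+ (m′ ∸ i)))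
                 (≡.cong g' (reversed-index n (ℕ.≤-pred i<m) (ℕ.≤-pred j<m))))))
             (reflexive (≡.cong (pow D) (≡.sym (+[m+m]∸2 n m′)))))
           (prefixes-lamProd lam lamNZ k′ m) ⟩
    (G * pow D (n ℕ.+ (m ℕ.+ m) ∸ 2)) * (pow (Λ K) m * lamProd lam lamNZ K k)
      ≈⟨ solve 4 (λ g d x l → (g :* d) :* (x :* l) := x :* ((l :* d) :* g)) refl _ _ _ _ ⟩
    pow (Λ K) m * ((lamProd lam lamNZ K k * pow D (n ℕ.+ (m ℕ.+ m) ∸ 2)) * G) ∎)
  where
  open TridiagonalMatrices F
  open FieldDefs F using (μ; lamProd)
  k m K e : ℕ
  k = suc k′
  m = suc m′
  K = k′ ℕ.+ m
  -- This is n+2m-2 without truncated subtraction: both the shift of the moments and the time at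
  -- which `w` is the last unit row.
  e = n ℕ.+ (m′ ℕ.+ m′)
  open Tridiagonal b lam
  open Paths K using (pathColumn; pathColumn-orbit; pathColumn-start; pathColumn-cut)
  w : ℕ → ℕ → Carrier
  w = reversedRow b lam K ext e
  D G : Carrier
  D = detℕ (suc K) entry
  G = det m (λ i j → g' (ℤ.- + (n ℕ.+ toℕ i ℕ.+ toℕ j)))
  open HankelDuality k′ m′ e {pathColumn} pathColumn-orbit pathColumn-start pathColumn-cut
    {w} (reversedRow-orbit b lam K ext e) (reversedRow-start b lam K ext e) using (duality)
  moment-index : ∀ i j → n ℕ.+ i ℕ.+ j ℕ.+ (m ℕ.+ m) ∸ 2 ≡ e ℕ.+ i ℕ.+ j
  moment-index i j = ≡.trans (+[m+m]∸2 (n ℕ.+ i ℕ.+ j) m′) (regroup n (m′ ℕ.+ m′) i j)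
    where
    regroup : ∀ n x i j → n ℕ.+ i ℕ.+ j ℕ.+ x ≡ n ℕ.+ x ℕ.+ i ℕ.+ j
    regroup = ℕ-Solver.solve-∀
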